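{- In the secretary setting of online pen testing with random order and full information, there is an $O\left(\frac{\log n}{\log\log n}\right)$-competitive algorithm, and this is tight up to a constant factor. That is, there are universal constants $C,c>0$ such that for all sufficiently large $n$: (i) there is a $\left(C\,\frac{\log n}{\log\log n}\right)$-competitive player; and (ii) every $\alpha$ for which an $\alpha$-competitive player exists satisfies $\alpha\ge c\,\frac{\log n}{\log\log n}$.
   Context: Online pen testing: an instance is given by values $X_1,\ldots,X_n \ge 0$, hidden from the player. At each step $i=1,2,\ldots,n$ in order, the player first picks a threshold $\theta_i \in [0,+\infty]$. If $X_i > \theta_i$ the test passes (and the player learns only that it passed); if $X_i \le \theta_i$ the test fails and the player observes $X_i$. The remaining utility of option $i$ becomes $X_i' = \max\{X_i-\theta_i,0\}$ (which is $0$ if $\theta_i=+\infty$). The player then irrevocably accepts or rejects option $i$; upon acceptance the game ends with score $X_i'$. If no option is ever accepted the score is $0$. The player knows $n$ and may be randomized: $\theta_i$ may depend on the information given in advance, on the outcomes of the previous tests and on internal randomness (independent of the arrival order), and the accept/reject decision may in addition depend on the outcome of test $i$. Secretary setting with random order and full information: there are numbers $a_1,\ldots,a_n\ge 0$, all given to the player in advance, and $(X_1,\ldots,X_n)$ is a uniformly random permutation of $(a_1,\ldots,a_n)$, unknown to the player. A player (a strategy taking $a_1,\ldots,a_n$ as input) is $\alpha$-competitive if for all $a_1,\ldots,a_n\ge0$ its expected score, over the permutation and its own randomness, is at least $\frac1\alpha\max_i a_i$. -}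

module Defs where

open import Level using (0ℓ)
open import Algebra.Bundles using (CommutativeRing; Semiring)
open import Algebra.Core using (Op₁; Op₂)
open import Algebra.Structures using (IsCommutativeRing)
open import Data.Bool using (Bool; true; if_then_else_)
open import Data.Fin using (Fin; zero; toℕ)
open import Data.Fin.Permutation as Perm using (Permutation′; _⟨$⟩ʳ_)
open import Data.List using (List; []; _∷_; foldr; map; length; allFin; concatMap)
open import Data.Nat using (ℕ; suc)
open import Data.Product using (_×_; ∃; Σ-syntax; ∃-syntax)
open import Data.Vec as Vec using (Vec; []; _∷_)
open import Data.Vec.Relation.Unary.All using (All)
open import Relation.Binary.Bundles using (DecTotalOrder)
open import Relation.Binary.Core using (Rel)
open import Relation.Binary.Structures using (IsDecTotalOrder)
open import Relation.Binary.PropositionalEquality using (_≡_; _≢_)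
open import Relation.Nullary using (¬_)
open import Relation.Nullary.Decidable using (does)
open import Relation.Unary using (Pred; U; ∁; ⋃; _≐_; _⊥_)

import Algebra.Construct.NaturalChoice.Max as NaturalMax
import Algebra.Definitions.RawSemiring as RawSemiringOps
import Data.List.Extrema as Extrema

-- The classical real numbers, characterised (up to isomorphism) as a
-- Dedekind-complete ordered field.  The operations _⁻¹ and sup are total,
-- with unspecified values at 0# and at sets that are empty or unbounded above.

record RealNumbers : Set₁ where
  infix  4 _≤_
  infixl 6 _+_
  infixl 7 _*_
  infix  8 -_ _⁻¹
  field
    ℝ       : Set
    _≤_     : Rel ℝ 0ℓ
    _+_ _*_ : Op₂ ℝ
    -_ _⁻¹  : Op₁ ℝ
    0# 1#   : ℝ

    isCommutativeRing : IsCommutativeRing _≡_ _+_ _*_ -_ 0# 1#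
    0≢1               : 0# ≢ 1#
    *-inverseʳ        : ∀ x → x ≢ 0# → x * x ⁻¹ ≡ 1#

    isDecTotalOrder   : IsDecTotalOrder _≡_ _≤_
    +-monoˡ-≤         : ∀ z {x y} → x ≤ y → x + z ≤ y + z
    *-nonNegative     : ∀ {x y} → 0# ≤ x → 0# ≤ y → 0# ≤ x * y

  UpperBound : Pred ℝ 0ℓ → Pred ℝ 0ℓ
  UpperBound S b = ∀ x → S x → x ≤ b

  IsSupremum : Pred ℝ 0ℓ → Pred ℝ 0ℓ
  IsSupremum S s = UpperBound S s × (∀ b → UpperBound S b → s ≤ b)

  field
    sup            : Pred ℝ 0ℓ → ℝ
    sup-isSupremum : ∀ S → ∃ S → ∃ (UpperBound S) → IsSupremum S (sup S)

  commutativeRing : CommutativeRing 0ℓ 0ℓ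
  commutativeRing = record { isCommutativeRing = isCommutativeRing }

  decTotalOrder : DecTotalOrder 0ℓ 0ℓ 0ℓ
  decTotalOrder = record { isDecTotalOrder = isDecTotalOrder }

  open IsDecTotalOrder isDecTotalOrder public using (_≤?_)
  open RawSemiringOps (Semiring.rawSemiring (CommutativeRing.semiring commutativeRing)) public
    using (_^_; sum) renaming (_×_ to _×ℕ_)
  open NaturalMax (DecTotalOrder.totalOrder decTotalOrder) public using (_⊔_)
  open Extrema (DecTotalOrder.totalOrder decTotalOrder) public using (max)

  infix  4 _<_
  infixl 6 _-_
  infixl 7 _/_

  _<_ : Rel ℝ 0ℓ
  x < y = ¬ (y ≤ x)

  _-_ _/_ : Op₂ ℝ
  x - y = x + - y
  x / y = x * y ⁻¹

  fromℕ : ℕ → ℝ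
  fromℕ n = n ×ℕ 1#

  -- For y > 0 this is sup { r ∈ ℚ : 2^r ≤ y }, where r = (m − k) / q.
  log₂ : ℝ → ℝ
  log₂ y = sup λ r → ∃[ m ] ∃[ k ] ∃[ q ]
    q ≢ 0 ×
    fromℕ 2 ^ m ≤ fromℕ 2 ^ k * y ^ q ×
    r ≡ (fromℕ m - fromℕ k) / fromℕ q

  average : List ℝ → ℝ
  average xs = foldr _+_ 0# xs / fromℕ (length xs)

-- Every permutation of Fin (suc n) is determined by the image i of zero and a
-- permutation of the remaining n positions, so each one is listed exactly once.

allPermutations : ∀ n → List (Permutation′ n)
allPermutations 0       = Perm.id ∷ []
allPermutations (suc n) =
  concatMap (λ i → map (Perm.insert zero i) (allPermutations n)) (allFin (suc n))

module Probability (R : RealNumbers) where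
  open RealNumbers R

  record ProbabilitySpace : Set₁ where
    field
      Ω          : Set
      Measurable : Pred (Pred Ω 0ℓ) 0ℓ
      μ          : Pred Ω 0ℓ → ℝ   -- unspecified on non-measurable sets

      measurable-≐ : ∀ {A B} → A ≐ B → Measurable A → Measurable B
      measurable-U : Measurable U
      measurable-∁ : ∀ {A} → Measurable A → Measurable (∁ A)
      measurable-⋃ : ∀ (A : ℕ → Pred Ω 0ℓ) → (∀ k → Measurable (A k)) →
                     Measurable (⋃ ℕ A)

      μ-cong        : ∀ {A B} → Measurable A → A ≐ B → μ A ≡ μ B
      μ-nonNegative : ∀ {A} → Measurable A → 0# ≤ μ A
      μ-U           : μ U ≡ 1#
      -- The sum of a series of non-negative terms is the supremum of its
      -- partial sums.
      μ-⋃           : ∀ (A : ℕ → Pred Ω 0ℓ) → (∀ k → Measurable (A k)) →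
                      (∀ {j k} → j ≢ k → A j ⊥ A k) →
                      IsSupremum
                        (λ s → ∃[ m ] s ≡ sum {m} (λ k → μ (A (toℕ k))))
                        (μ (⋃ ℕ A))

    -- A simple function takes the value `value j` on the j-th piece of a
    -- finite measurable partition of Ω.
    record SimpleFunction : Set where
      field
        {pieces}   : ℕ
        piece      : Ω → Fin pieces
        value      : Fin pieces → ℝ
        measurable : ∀ j → Measurable (λ ω → piece ω ≡ j)

      apply : Ω → ℝ
      apply ω = value (piece ω)

      integral : ℝ
      integral = sum (λ j → value j * μ (λ ω → piece ω ≡ j))

    -- The Lebesgue integral of a bounded non-negative measurable function.
    expectation : (Ω → ℝ) → ℝ
    expectation f = sup λ v → Σ[ s ∈ SimpleFunction ]
      (∀ ω → 0# ≤ SimpleFunction.apply s ω × SimpleFunction.apply s ω ≤ f ω) ×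
      v ≡ SimpleFunction.integral s

module PenTesting (R : RealNumbers) where
  open RealNumbers R
  open Probability R

  data Threshold : Set where
    finite : (θ : ℝ) → 0# ≤ θ → Threshold
    ∞      : Threshold

  infix 4 _≤ᵗ_

  data _≤ᵗ_ : Threshold → ℝ → Set where
    finite : ∀ {θ 0≤θ t} → θ ≤ t → finite θ 0≤θ ≤ᵗ t

  data Outcome : Set where
    passed : Outcome
    failed : (x : ℝ) → Outcome

  test : ℝ → Threshold → Outcome
  test x (finite θ _) = if does (x ≤? θ) then failed x else passed
  test x ∞            = failed x

  remaining : ℝ → Threshold → ℝ
  remaining x (finite θ _) = (x - θ) ⊔ 0#
  remaining x ∞            = 0#

  -- Outcomes of the tests made so far, the most recent one first.
  History : Set
  History = List Outcome

  -- The internal randomness is a point ω of a probability space.  In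
  -- `threshold a h ω` the history h consists of the earlier tests only, whereas
  -- in `accept a h ω` its head is the outcome for the option being decided on.
  -- All earlier options have necessarily been rejected.
  record Player (n : ℕ) : Set₁ where
    field
      space : ProbabilitySpace

    open ProbabilitySpace space public

    field
      threshold : Vec ℝ n → History → Ω → Threshold
      accept    : Vec ℝ n → History → Ω → Bool

      threshold-measurable : ∀ a h t → Measurable (λ ω → threshold a h ω ≤ᵗ t)
      accept-measurable    : ∀ a h → Measurable (λ ω → accept a h ω ≡ true)

    -- The score from the remaining hidden values, after the tests in h.
    play : Vec ℝ n → Ω → History → ∀ {k} → Vec ℝ k → ℝ
    play a ω h []       = 0#
    play a ω h (x ∷ xs) =
      let θ  = threshold a h ω
          h′ = test x θ ∷ h
      in if accept a h′ ω then remaining x θ else play a ω h′ xs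

    score : Vec ℝ n → Permutation′ n → Ω → ℝ
    score a π ω = play a ω [] (Vec.tabulate (λ i → Vec.lookup a (π ⟨$⟩ʳ i)))

    -- The permutation is uniform and independent of ω.
    expectedScore : Vec ℝ n → ℝ
    expectedScore a =
      average (map (λ π → expectation (score a π)) (allPermutations n))

  infix 4 _IsCompetitive_

  -- As the values are non-negative, starting the maximum at 0# only matters
  -- for n = 0.
  _IsCompetitive_ : ∀ {n} → Player n → ℝ → Set
  P IsCompetitive α =
    0# < α ×
    (∀ a → All (0# ≤_) a → 1# / α * max 0# (Vec.toList a) ≤ Player.expectedScore P a)

  log/loglog : ℕ → ℝ
  log/loglog n = log₂ (fromℕ n) / log₂ (log₂ (fromℕ n))

{-# OPTIONS --safe #-}

-- Upper bound.  Let M be the maximum, g = M / (J + 1), and c_s the number of unseen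
-- values above s g.  The player tests with threshold ∞ until c_{s+1} = c_s > 0 for
-- some s < J, and from then on with threshold s g, which gains at least g for sure.
-- The events "the last value above s g to arrive is above (s + 1) g" are independent
-- with probabilities ρ_s = c_{s+1} / c_s, so the player fails with probability
-- ∏ (1 - ρ_s).  As ∏ ρ_s ≥ 1 / n, at least q of the J = B + q ratios exceed 1 / q if
-- n < q^(B+1), and the product is at most 1 / 2.
--
-- Lower bound.  The values lie in {0, …, J}, J among them, and the level counts
-- #{i : a_i ≥ s} grow by factors of at least Q ≥ J² as s decreases.  While every
-- level count is at least twice the next one, the expected gain of an accepted passing
-- test is at most 2.  The ratio of two level counts is a supermartingale, so
-- by Doob's inequality the doubling ever fails with probability at most 2 J / Q.
--
-- With k = ⌊log₂ n⌋, integer division and 4^l ≤ k < 4^(l+1), the choices q = 2^l, B = k / l and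
-- Q = 2^(4l+4), J = k / (4l + 4) give J of order log n / log log n in both parts.

module Submission where

open import Algebra.Bundles using (CommutativeMonoid; CommutativeRing)
import Algebra.Construct.NaturalChoice.Max as NaturalMax
import Algebra.Properties.CommutativeMonoid.Sum
import Algebra.Properties.Ring
import Algebra.Properties.Semiring.Exp
import Algebra.Properties.Semiring.Mult
import Algebra.Properties.Semiring.Sum
import Algebra.Solver.Ring
open import Algebra.Solver.Ring.AlmostCommutativeRing using (_-Raw-AlmostCommutative⟶_; fromCommutativeRing)
open import Axiom.ExcludedMiddle using (ExcludedMiddle)
open import Data.Bool using (Bool; T; false; if_then_else_; not; true)
open import Data.Empty using (⊥-elim)
open import Data.Fin using (Fin; fromℕ<; punchIn; splitAt; suc; toℕ; zero)
import Data.Fin as F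
open import Data.Fin.Permutation as Perm using (Permutation′; _⟨$⟩ʳ_)
import Data.Fin.Properties as Fin
open import Data.Integer as ℤ using (ℤ; -[1+_]) renaming (+_ to pos)
import Data.Integer.Properties as ℤ
open import Data.List using (List; []; _++_; _∷_; allFin; concatMap; foldr; length; map)
import Data.List as List
import Data.List.Extrema as Extrema
import Data.List.Properties as List
import Data.List.Relation.Unary.All as All
open import Data.Maybe using (Maybe; just; nothing)
open import Data.Nat as ℕ using (ℕ; _≤ᵇ_; _≥_; suc; zero)
import Data.Nat.DivMod as ℕ
import Data.Nat.Properties as ℕ
open import Data.Nat.Solver using (module +-*-Solver)
open import Data.Product using (Σ-syntax; _,_; _×_; proj₁; proj₂; ∃-syntax)
open import Data.Sum using (_⊎_; inj₁; inj₂)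
open import Data.Unit using (tt; ⊤)
open import Data.Vec as Vec using (Vec; []; _∷_)
import Data.Vec.Functional as Vector
open import Data.Vec.Membership.Propositional.Properties using (∈-lookup; ∈-toList⁺; ∈-toList⁻)
import Data.Vec.Properties as Vec
open import Data.Vec.Relation.Unary.All using (All)
import Data.Vec.Relation.Unary.All.Properties as VecAll
import Data.Vec.Relation.Unary.Any as VecAny
import Data.Vec.Relation.Unary.Any.Properties as VecAny
open import Defs
open import Function using (_∘_; id)
open import Level using (0ℓ)
open import Relation.Binary.Bundles using (DecTotalOrder)
open import Relation.Binary.PropositionalEquality using (_≡_; _≢_; cong; cong₂; module ≡-Reasoning; refl; subst; subst₂; sym; trans)
import Relation.Binary.Reasoning.PartialOrder
open import Relation.Binary.Structures using (IsDecTotalOrder)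
open import Relation.Nullary using (Dec; does; no; yes; ¬_)
open import Relation.Nullary.Decidable using (decidable-stable)
open import Relation.Unary using (Pred; U; _∩_; _≐_; _⊥_; ∁; ∅; ⋃)

-- Both bounds are backward inductions on the multiset of unseen values, each carried by an explicit
-- function of the level counts; this takes the place of independence and of stopping times. The
-- player earns at least g (1 - Φ), with Φ the product of 1 - c_{s+1} / c_s over s < J: as long as
-- values are merely revealed, Φ does not grow on average; it is 0 once c_{s+1} = c_s > 0 for some s
-- < J, and 1 when nothing is left. In the other direction, with c_s now the level counts of the
-- hard instance, no player beats 2 + 2 J ∑ c_{s+1} / c_s. This is at least J, the largest possible
-- gain, as soon as one doubling fails. The obstacle for every player is that a passed test does not
-- reveal the value: the decision after it is common to all values above the threshold, so that only
-- their average gain counts. Q ≥ J² makes the sum contribute at most 2 at the start, whence a score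
-- of at most 4. Internal randomness is treated pointwise: the sum over all arrival orders is
-- bounded for each ω and integrated afterwards.

-- Ordered-field arithmetic, a ring solver for ℝ, and bounds on `log₂`.

module RealProperties (R : RealNumbers) where
  open RealNumbers R
  open CommutativeRing commutativeRing public
    using (+-comm; +-assoc; *-comm; *-assoc; +-identityˡ; +-identityʳ; *-identityˡ; *-identityʳ;
           zeroˡ; zeroʳ; distribˡ; distribʳ; -‿inverseʳ; ring; semiring)
  open IsDecTotalOrder isDecTotalOrder public using (total)
    renaming (refl to ≤-refl; reflexive to ≤-reflexive; trans to ≤-trans; antisym to ≤-antisym)
  open Algebra.Properties.Ring ring using (-‿distribˡ-*; -‿distribʳ-*; -‿involutive; -0#≈0#; -‿+-comm)
  open Algebra.Properties.Semiring.Mult semiring using (×-homo-+; ×1-homo-*)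
  open Algebra.Properties.Semiring.Exp semiring public using (^-homo-*)
  open Algebra.Properties.Semiring.Sum semiring public
    using (sum-cong-≗; sum-remove; ∑-distrib-+; ∑-comm; *-distribˡ-sum; *-distribʳ-sum; sum-replicate-zero)

  fromℕ-+ : ∀ m n → fromℕ (m ℕ.+ n) ≡ fromℕ m + fromℕ n
  fromℕ-+ m n = ×-homo-+ 1# m n

  fromℕ-* : ∀ m n → fromℕ (m ℕ.* n) ≡ fromℕ m * fromℕ n
  fromℕ-* = ×1-homo-*

  fromℕ-^ : ∀ m n → fromℕ (m ℕ.^ n) ≡ fromℕ m ^ n
  fromℕ-^ m zero    = +-identityʳ 1#
  fromℕ-^ m (suc n) = trans (fromℕ-* m (m ℕ.^ n)) (cong (fromℕ m *_) (fromℕ-^ m n))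

  private
    -- The ring solver takes its coefficients from ℤ, where equality is decided by computation, so
    -- that opposite terms cancel in normal forms.
    fromℤ : ℤ → ℝ
    fromℤ (pos n)    = fromℕ n
    fromℤ -[1+ n ] = - fromℕ (suc n)

    cancel-1 : ∀ x y → (1# + x) - (1# + y) ≡ x - y
    cancel-1 x y = begin
      (1# + x) + - (1# + y)     ≡⟨ cong₂ _+_ (+-comm 1# x) (sym (-‿+-comm 1# y)) ⟩
      (x + 1#) + (- 1# + - y)   ≡⟨ +-assoc x 1# _ ⟩
      x + (1# + (- 1# + - y))   ≡⟨ cong (x +_) (+-assoc 1# (- 1#) (- y)) ⟨
      x + ((1# + - 1#) + - y)   ≡⟨ cong (λ z → x + (z + - y)) (-‿inverseʳ 1#) ⟩
      x + (0# + - y)            ≡⟨ cong (x +_) (+-identityˡ (- y)) ⟩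
      x - y                     ∎
      where open ≡-Reasoning

    fromℤ-⊖ : ∀ m n → fromℤ (m ℤ.⊖ n) ≡ fromℕ m - fromℕ n
    fromℤ-⊖ m       zero    = sym (trans (cong (fromℕ m +_) -0#≈0#) (+-identityʳ _))
    fromℤ-⊖ zero    (suc n) = sym (+-identityˡ _)
    fromℤ-⊖ (suc m) (suc n) = trans (cong fromℤ (ℤ.[1+m]⊖[1+n]≡m⊖n m n))
      (trans (fromℤ-⊖ m n) (sym (cancel-1 (fromℕ m) (fromℕ n))))

    fromℤ-+ : ∀ i j → fromℤ (i ℤ.+ j) ≡ fromℤ i + fromℤ j
    fromℤ-+ (pos m)    (pos n)    = fromℕ-+ m n
    fromℤ-+ (pos m)    -[1+ n ] = fromℤ-⊖ m (suc n)
    fromℤ-+ -[1+ m ] (pos n)    = trans (fromℤ-⊖ n (suc m)) (+-comm _ _)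
    fromℤ-+ -[1+ m ] -[1+ n ] = trans
      (cong -_ (trans (cong (λ k → fromℕ (suc k)) (sym (ℕ.+-suc m n))) (fromℕ-+ (suc m) (suc n))))
      (sym (-‿+-comm _ _))

    fromℤ-neg : ∀ i → fromℤ (ℤ.- i) ≡ - fromℤ i
    fromℤ-neg (pos zero)  = sym -0#≈0#
    fromℤ-neg (pos (suc n)) = refl
    fromℤ-neg -[1+ n ]  = sym (-‿involutive _)

    fromℤ-*⁺ : ∀ m j → fromℤ (pos m ℤ.* j) ≡ fromℕ m * fromℤ j
    fromℤ-*⁺ m (pos n)    = trans (cong fromℤ (sym (ℤ.pos-* m n))) (fromℕ-* m n)
    fromℤ-*⁺ m -[1+ n ] = begin
      fromℤ (pos m ℤ.* (ℤ.- pos (suc n))) ≡⟨ cong fromℤ (ℤ.neg-distribʳ-* (pos m) (pos (suc n))) ⟨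
      fromℤ (ℤ.- (pos m ℤ.* pos (suc n)))   ≡⟨ fromℤ-neg (pos m ℤ.* pos (suc n)) ⟩
      - fromℤ (pos m ℤ.* pos (suc n))       ≡⟨ cong -_ (fromℤ-*⁺ m (pos (suc n))) ⟩
      - (fromℕ m * fromℕ (suc n))     ≡⟨ -‿distribʳ-* _ _ ⟩
      fromℕ m * - fromℕ (suc n)       ∎
      where open ≡-Reasoning

    fromℤ-* : ∀ i j → fromℤ (i ℤ.* j) ≡ fromℤ i * fromℤ j
    fromℤ-* (pos m)    j = fromℤ-*⁺ m j
    fromℤ-* -[1+ m ] j = begin
      fromℤ ((ℤ.- pos (suc m)) ℤ.* j) ≡⟨ cong fromℤ (ℤ.neg-distribˡ-* (pos (suc m)) j) ⟨
      fromℤ (ℤ.- (pos (suc m) ℤ.* j))   ≡⟨ fromℤ-neg (pos (suc m) ℤ.* j) ⟩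
      - fromℤ (pos (suc m) ℤ.* j)       ≡⟨ cong -_ (fromℤ-*⁺ (suc m) j) ⟩
      - (fromℕ (suc m) * fromℤ j)   ≡⟨ -‿distribˡ-* _ _ ⟩
      - fromℕ (suc m) * fromℤ j     ∎
      where open ≡-Reasoning

    morphism : CommutativeRing.rawRing ℤ.+-*-commutativeRing -Raw-AlmostCommutative⟶
               fromCommutativeRing commutativeRing
    morphism = record
      { ⟦_⟧    = fromℤ
      ; +-homo = fromℤ-+
      ; *-homo = fromℤ-*
      ; -‿homo = fromℤ-neg
      ; 0-homo = refl
      ; 1-homo = +-identityʳ 1#
      }

    coeff≟ : ∀ i j → Maybe (fromℤ i ≡ fromℤ j)
    coeff≟ i j with i ℤ.≟ j
    ... | yes i≡j = just (cong fromℤ i≡j)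
    ... | no  _   = nothing

  module Solver = Algebra.Solver.Ring _ (fromCommutativeRing commutativeRing) morphism coeff≟
  open Solver public using (solve; con; _:=_; _:+_; _:*_; _:-_; :-_)

  0′ : ∀ {n} → Solver.Polynomial n
  0′ = con (pos 0)

  1′ : ∀ {n} → Solver.Polynomial n
  1′ = con (pos 1)

  2′ : ∀ {n} → Solver.Polynomial n
  2′ = con (pos 2)

  -- The solver interprets the constant 1 as fromℕ 1, which is not 1# by computation.
  fromℕ-1 : fromℕ 1 ≡ 1#
  fromℕ-1 = +-identityʳ 1#

  module ≤-Reasoning = Relation.Binary.Reasoning.PartialOrder (DecTotalOrder.poset decTotalOrder)

  +-monoʳ-≤ : ∀ z {x y} → x ≤ y → z + x ≤ z + y
  +-monoʳ-≤ z {x} {y} x≤y = subst₂ _≤_ (+-comm x z) (+-comm y z) (+-monoˡ-≤ z x≤y)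

  +-mono-≤ : ∀ {x y u v} → x ≤ y → u ≤ v → x + u ≤ y + v
  +-mono-≤ {y = y} {u} x≤y u≤v = ≤-trans (+-monoˡ-≤ u x≤y) (+-monoʳ-≤ y u≤v)

  -- Every linear inequality is reduced by `transfer` to an equation that the
  -- ring solver proves.
  transfer : ∀ {x y u v} → x ≤ y → u + y ≡ v + x → u ≤ v
  transfer {x} {y} {u} {v} x≤y eq = subst₂ _≤_ left right (+-monoˡ-≤ (- y) (+-monoʳ-≤ v x≤y))
    where
    left : v + x - y ≡ u
    left = trans (cong (_- y) (sym eq)) (solve 2 (λ u y → u :+ y :- y := u) refl u y)
    right : v + y - y ≡ v
    right = solve 2 (λ v y → v :+ y :- y := v) refl v y

  x≤y⇒0≤y-x : ∀ {x y} → x ≤ y → 0# ≤ y - x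
  x≤y⇒0≤y-x {x} {y} x≤y = transfer x≤y (solve 2 (λ x y → 0′ :+ y := y :- x :+ x) refl x y)

  *-monoˡ-≤ : ∀ {x y} z → 0# ≤ z → x ≤ y → z * x ≤ z * y
  *-monoˡ-≤ {x} {y} z 0≤z x≤y = transfer (*-nonNegative 0≤z (x≤y⇒0≤y-x x≤y))
    (solve 3 (λ x y z → z :* x :+ z :* (y :- x) := z :* y :+ 0′) refl x y z)

  *-monoʳ-≤ : ∀ {x y} z → 0# ≤ z → x ≤ y → x * z ≤ y * z
  *-monoʳ-≤ {x} {y} z 0≤z x≤y = subst₂ _≤_ (*-comm z x) (*-comm z y) (*-monoˡ-≤ z 0≤z x≤y)

  *-mono-≤ : ∀ {x y u v} → 0# ≤ y → 0# ≤ u → x ≤ y → u ≤ v → x * u ≤ y * v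
  *-mono-≤ {y = y} {u} 0≤y 0≤u x≤y u≤v = ≤-trans (*-monoʳ-≤ u 0≤u x≤y) (*-monoˡ-≤ y 0≤y u≤v)

  <⇒≤ : ∀ {x y} → x < y → x ≤ y
  <⇒≤ {x} {y} x<y with total x y
  ... | inj₁ x≤y = x≤y
  ... | inj₂ y≤x = ⊥-elim (x<y y≤x)

  <-≤-trans : ∀ {x y z} → x < y → y ≤ z → x < z
  <-≤-trans x<y y≤z z≤x = x<y (≤-trans y≤z z≤x)

  ≤-<-trans : ∀ {x y z} → x ≤ y → y < z → x < z
  ≤-<-trans x≤y y<z z≤x = y<z (≤-trans z≤x x≤y)

  <⇒≢ : ∀ {x} → 0# < x → x ≢ 0#
  <⇒≢ 0<x refl = 0<x ≤-refl

  0≤1 : 0# ≤ 1#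
  0≤1 with total 0# 1#
  ... | inj₁ p = p
  ... | inj₂ p = subst (0# ≤_) (trans (solve 1 (λ x → (:- x) :* (:- x) := x :* x) refl 1#) (*-identityˡ 1#))
                   (*-nonNegative 0≤-1 0≤-1)
    where
    0≤-1 : 0# ≤ - 1#
    0≤-1 = transfer p (solve 1 (λ x → 0′ :+ 0′ := :- x :+ x) refl 1#)

  0<1 : 0# < 1#
  0<1 1≤0 = 0≢1 (≤-antisym 0≤1 1≤0)

  fromℕ-nonNeg : ∀ n → 0# ≤ fromℕ n
  fromℕ-nonNeg zero    = ≤-refl
  fromℕ-nonNeg (suc n) = subst (_≤ 1# + fromℕ n) (+-identityʳ 0#) (+-mono-≤ 0≤1 (fromℕ-nonNeg n))

  fromℕ-mono : ∀ {m n} → m ℕ.≤ n → fromℕ m ≤ fromℕ n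
  fromℕ-mono {n = n} ℕ.z≤n = fromℕ-nonNeg n
  fromℕ-mono (ℕ.s≤s m≤n)   = +-monoʳ-≤ 1# (fromℕ-mono m≤n)

  fromℕ-pos : ∀ n → 0# < fromℕ (suc n)
  fromℕ-pos n = <-≤-trans 0<1 (subst (_≤ fromℕ (suc n)) fromℕ-1 (fromℕ-mono {1} {suc n} (ℕ.s≤s ℕ.z≤n)))

  fromℕ-pos′ : ∀ {n} → 0 ℕ.< n → 0# < fromℕ n
  fromℕ-pos′ (ℕ.s≤s {n = n} _) = fromℕ-pos n

  fromℕ-cancel-≤ : ∀ {m n} → fromℕ m ≤ fromℕ n → m ℕ.≤ n
  fromℕ-cancel-≤ {m} {n} p with m ℕ.≤? n
  ... | yes q = q
  ... | no  q = ⊥-elim (0<1 (transfer (≤-trans (fromℕ-mono (ℕ.≰⇒> q)) p)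
                  (solve 2 (λ o x → o :+ x := 0′ :+ (o :+ x)) refl 1# (fromℕ n))))

  *-cancelˡ-≤ : ∀ {x y} z → 0# < z → z * x ≤ z * y → x ≤ y
  *-cancelˡ-≤ {x} {y} z 0<z p with total x y
  ... | inj₁ x≤y = x≤y
  ... | inj₂ y≤x = ≤-reflexive (begin
      x                 ≡⟨ unit x ⟩
      z ⁻¹ * (z * x)    ≡⟨ cong (z ⁻¹ *_) (≤-antisym p (*-monoˡ-≤ z (<⇒≤ 0<z) y≤x)) ⟩
      z ⁻¹ * (z * y)    ≡⟨ unit y ⟨
      y                 ∎)
    where
    open ≡-Reasoning
    unit : ∀ w → w ≡ z ⁻¹ * (z * w)
    unit w = sym (trans (solve 3 (λ i z w → i :* (z :* w) := (z :* i) :* w) refl (z ⁻¹) z w)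
      (trans (cong (_* w) (*-inverseʳ z (<⇒≢ 0<z))) (*-identityˡ w)))

  *-pos : ∀ {x y} → 0# < x → 0# < y → 0# < x * y
  *-pos {x} {y} 0<x 0<y p = 0<y (*-cancelˡ-≤ x 0<x (subst (x * y ≤_) (sym (zeroʳ x)) p))

  x*[y/x]≡y : ∀ {x} y → 0# < x → x * (y / x) ≡ y
  x*[y/x]≡y {x} y 0<x = trans (solve 3 (λ x y i → x :* (y :* i) := (x :* i) :* y) refl x y (x ⁻¹))
    (trans (cong (_* y) (*-inverseʳ x (<⇒≢ 0<x))) (*-identityˡ y))

  y≤z*x⇒y/x≤z : ∀ {x y z} → 0# < x → y ≤ x * z → y / x ≤ z
  y≤z*x⇒y/x≤z {x} {y} 0<x p = *-cancelˡ-≤ x 0<x (subst (_≤ _) (sym (x*[y/x]≡y y 0<x)) p)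

  z*x≤y⇒z≤y/x : ∀ {x y z} → 0# < x → x * z ≤ y → z ≤ y / x
  z*x≤y⇒z≤y/x {x} {y} 0<x p = *-cancelˡ-≤ x 0<x (subst (_ ≤_) (sym (x*[y/x]≡y y 0<x)) p)

  ^-nonNeg : ∀ {x} → 0# ≤ x → ∀ n → 0# ≤ x ^ n
  ^-nonNeg 0≤x zero    = 0≤1
  ^-nonNeg 0≤x (suc n) = *-nonNegative 0≤x (^-nonNeg 0≤x n)

  ^-monoˡ-≤ : ∀ {x y} → 0# ≤ x → x ≤ y → ∀ n → x ^ n ≤ y ^ n
  ^-monoˡ-≤ 0≤x x≤y zero    = ≤-refl
  ^-monoˡ-≤ 0≤x x≤y (suc n) = *-mono-≤ (≤-trans 0≤x x≤y) (^-nonNeg 0≤x n) x≤y (^-monoˡ-≤ 0≤x x≤y n)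

  sum-mono : ∀ {n} {f g : Fin n → ℝ} → (∀ i → f i ≤ g i) → sum f ≤ sum g
  sum-mono {zero}  f≤g = ≤-refl
  sum-mono {suc n} f≤g = +-mono-≤ (f≤g zero) (sum-mono (f≤g ∘ suc))

  sum-const : ∀ n x → sum {n} (λ _ → x) ≡ fromℕ n * x
  sum-const zero    x = sym (zeroˡ x)
  sum-const (suc n) x = trans (cong (x +_) (sum-const n x))
    (trans (cong (_+ fromℕ n * x) (sym (*-identityˡ x))) (sym (distribʳ x 1# (fromℕ n))))

  sum-nonNeg : ∀ {n} {f : Fin n → ℝ} → (∀ i → 0# ≤ f i) → 0# ≤ sum f
  sum-nonNeg {n} {f} 0≤f = subst (_≤ sum f) (trans (sum-const n 0#) (zeroʳ _)) (sum-mono 0≤f)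

  term≤sum : ∀ {n} (f : Fin n → ℝ) → (∀ i → 0# ≤ f i) → ∀ i → f i ≤ sum f
  term≤sum {suc n} f 0≤f i = subst₂ _≤_ (+-identityʳ _) (sym (sum-remove {i = i} f))
    (+-monoʳ-≤ (f i) (sum-nonNeg {n} (0≤f ∘ punchIn i)))

  -- `fromℕ a` is itself one of the rationals in the supremum, and 2^m ≤ 2^k y^q ≤ 2^(k + b q)
  -- forces m ≤ k + b q, so all of them are at most b. The two bounds are proved together because
  -- each makes `sup` meaningful for the other: one shows the set inhabited, the other bounded.
  log₂-bounds : ∀ {y} a b → fromℕ 2 ^ a ≤ y → y ≤ fromℕ 2 ^ b → fromℕ a ≤ log₂ y × log₂ y ≤ fromℕ b
  log₂-bounds {y} a b 2^a≤y y≤2^b = proj₁ supremum _ a∈S , proj₂ supremum _ upper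
    where
    two = fromℕ 2
    S : ℝ → Set
    S r = ∃[ m ] ∃[ k ] ∃[ q ] q ≢ 0 × two ^ m ≤ two ^ k * y ^ q × r ≡ (fromℕ m - fromℕ k) / fromℕ q

    a∈S : S (fromℕ a)
    a∈S = a , 0 , 1 , (λ ()) ,
      subst (two ^ a ≤_) (solve 1 (λ y → y := 1′ :* (y :* 1′)) refl y ■ cong (λ o → o * (y * o)) fromℕ-1)
          2^a≤y ,
      ≤-antisym (z*x≤y⇒z≤y/x (fromℕ-pos 0) (≤-reflexive eq))
          (y≤z*x⇒y/x≤z (fromℕ-pos 0) (≤-reflexive (sym eq)))
      where
      infixr 4 _■_
      _■_ = trans
      eq : fromℕ 1 * fromℕ a ≡ fromℕ a - fromℕ 0
      eq = solve 1 (λ a → 1′ :* a := a :- 0′) refl (fromℕ a)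

    0≤two : 0# ≤ two
    0≤two = fromℕ-nonNeg 2

    0≤y : 0# ≤ y
    0≤y = ≤-trans (^-nonNeg 0≤two a) 2^a≤y

    upper : UpperBound S (fromℕ b)
    upper r (m , k , zero , q≢0 , _ , _) = ⊥-elim (q≢0 refl)
    upper _ (m , k , q@(suc q′) , _ , p , refl) = y≤z*x⇒y/x≤z (fromℕ-pos q′)
      (transfer (fromℕ-mono exponents) (trans
        (cong (fromℕ m - fromℕ k +_) (trans (fromℕ-+ k (b ℕ.* q)) (cong (_ +_) (fromℕ-* b q))))
        (solve 4 (λ m k b q → m :- k :+ (k :+ b :* q) := q :* b :+ m) refl (fromℕ m) (fromℕ k) (fromℕ b)
            (fromℕ q))))
      where
      power-bound : fromℕ (2 ℕ.^ m) ≤ fromℕ (2 ℕ.^ (k ℕ.+ b ℕ.* q))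
      power-bound = subst₂ _≤_ (sym (fromℕ-^ 2 m))
        (sym (trans (fromℕ-^ 2 (k ℕ.+ b ℕ.* q)) (trans (^-homo-* two k (b ℕ.* q))
          (cong (two ^ k *_) (sym (Algebra.Properties.Semiring.Exp.^-assocʳ semiring two b q))))))
        (≤-trans p (*-monoˡ-≤ (two ^ k) (^-nonNeg 0≤two k) (^-monoˡ-≤ 0≤y y≤2^b q)))
      exponents : m ℕ.≤ k ℕ.+ b ℕ.* q
      exponents with m ℕ.≤? k ℕ.+ b ℕ.* q
      ... | yes le = le
      ... | no  gt = ⊥-elim (ℕ.<⇒≱ (ℕ.^-monoʳ-< 2 (ℕ.s≤s (ℕ.s≤s ℕ.z≤n)) (ℕ.≰⇒> gt))
          (fromℕ-cancel-≤ power-bound))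

    supremum : IsSupremum S (log₂ y)
    supremum = sup-isSupremum S (_ , a∈S) (_ , upper)

-- Finite sums and integration of simple functions.

module ListSums (R : RealNumbers) where
  open RealNumbers R
  open RealProperties R

  listSum : ∀ {I : Set} → (I → ℝ) → List I → ℝ
  listSum f xs = foldr _+_ 0# (map f xs)

  listSum-cong : ∀ {I : Set} {f g : I → ℝ} → (∀ i → f i ≡ g i) → ∀ xs → listSum f xs ≡ listSum g xs
  listSum-cong f≗g []       = refl
  listSum-cong f≗g (x ∷ xs) = cong₂ _+_ (f≗g x) (listSum-cong f≗g xs)

  listSum-mono : ∀ {I : Set} {f g : I → ℝ} → (∀ i → f i ≤ g i) → ∀ xs → listSum f xs ≤ listSum g xs
  listSum-mono f≤g []       = ≤-refl
  listSum-mono f≤g (x ∷ xs) = +-mono-≤ (f≤g x) (listSum-mono f≤g xs)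

  listSum-sum : ∀ {I : Set} {n} (f : I → Fin n → ℝ) xs →
                listSum (λ i → sum (f i)) xs ≡ sum (λ j → listSum (λ i → f i j) xs)
  listSum-sum {n = n} f []       = sym (sum-replicate-zero n)
  listSum-sum f (x ∷ xs) = trans (cong (sum (f x) +_) (listSum-sum f xs)) (sym (∑-distrib-+ (f x) _))

module Integration (em : ExcludedMiddle 0ℓ) (R : RealNumbers)
                   (space : Probability.ProbabilitySpace R) where
  open RealNumbers R
  open RealProperties R
  open ListSums R
  open Probability R
  open ProbabilitySpace space

  measurable-∅ : Measurable ∅
  measurable-∅ = measurable-≐ ((λ ¬u → ¬u _) , λ ()) (measurable-∁ measurable-U)

  measurable-∩ : ∀ {A B} → Measurable A → Measurable B → Measurable (A ∩ B)
  measurable-∩ {A} {B} mA mB = measurable-≐ (to , from) (measurable-∁ (measurable-⋃ F measurable-F))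
    where
    F : ℕ → Pred Ω 0ℓ
    F zero    = ∁ A
    F (suc _) = ∁ B
    measurable-F : ∀ k → Measurable (F k)
    measurable-F zero    = measurable-∁ mA
    measurable-F (suc _) = measurable-∁ mB
    to : ∀ {ω} → ∁ (⋃ ℕ F) ω → (A ∩ B) ω
    to {ω} h with em {A ω} | em {B ω}
    ... | yes a | yes b = a , b
    ... | no ¬a | _     = ⊥-elim (h (0 , ¬a))
    ... | yes _ | no ¬b = ⊥-elim (h (1 , ¬b))
    from : ∀ {ω} → (A ∩ B) ω → ∁ (⋃ ℕ F) ω
    from (a , b) (zero  , ¬a) = ¬a a
    from (a , b) (suc _ , ¬b) = ¬b b

  -- In countable additivity for the constant sequence `∅`, the partial sum of two terms already
  -- gives 2 μ(∅) ≤ μ(∅).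
  μ-∅ : μ ∅ ≡ 0#
  μ-∅ = ≤-antisym
    (transfer (proj₁ supremum _ (2 , refl))
      (solve 1 (λ x → x :+ x := 0′ :+ (x :+ (x :+ 0′))) refl (μ ∅)))
    (μ-nonNegative measurable-∅)
    where
    supremum : IsSupremum _ (μ ∅)
    supremum = subst (IsSupremum _) (sym (μ-cong measurable-∅ ((λ ()) , λ ())))
      (μ-⋃ (λ _ → ∅) (λ _ → measurable-∅) (λ _ → λ ()))

  μ-empty : ∀ {A} → (∀ ω → ¬ A ω) → μ A ≡ 0#
  μ-empty ¬A = trans (sym (μ-cong measurable-∅ ((λ ()) , λ {ω} a → ⊥-elim (¬A ω a)))) μ-∅

  private
    sum-truncate : ∀ m n (u : ℕ → ℝ) → (∀ k → 0# ≤ u k) → (∀ k → n ℕ.≤ k → u k ≡ 0#) →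
                   sum {m} (u ∘ toℕ) ≤ sum {n} (u ∘ toℕ)
    sum-truncate zero    n       u 0≤u _ = sum-nonNeg {n} (0≤u ∘ toℕ)
    sum-truncate (suc m) zero    u _ u≡0 = ≤-reflexive
      (trans (sum-cong-≗ {suc m} (λ i → u≡0 (toℕ i) ℕ.z≤n)) (trans (sum-const (suc m) 0#) (zeroʳ _)))
    sum-truncate (suc m) (suc n) u 0≤u u≡0 = +-monoʳ-≤ (u 0)
      (sum-truncate m n (u ∘ suc) (0≤u ∘ suc) (λ k n≤k → u≡0 (suc k) (ℕ.s≤s n≤k)))

  -- Finite additivity comes from the countable axiom by continuing the n pieces with empty sets,
  -- after which the partial sums no longer grow.
  μ-partition : ∀ {A n} (piece : Ω → Fin n) → Measurable A →
                (∀ j → Measurable (λ ω → piece ω ≡ j)) →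
                μ A ≡ sum (λ j → μ (A ∩ λ ω → piece ω ≡ j))
  μ-partition {A} {n} piece mA mPiece = trans (sym (μ-cong measurable-⋃B ⋃B≐A)) (trans
    (≤-antisym (proj₂ supremum _ bounded) (proj₁ supremum _ (n , refl)))
    (sum-cong-≗ {n} (λ j → sym (μ-cong (measurable-∩ mA (mPiece j))
      ((λ (a , eq) → a , cong toℕ eq) , λ (a , eq) → a , Fin.toℕ-injective eq)))))
    where
    B : ℕ → Pred Ω 0ℓ
    B k = A ∩ λ ω → toℕ (piece ω) ≡ k

    B-empty : ∀ k → n ℕ.≤ k → ∀ ω → ¬ B k ω
    B-empty _ n≤k ω (_ , refl) = ℕ.<⇒≱ (Fin.toℕ<n (piece ω)) n≤k

    measurable-B : ∀ k → Measurable (B k)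
    measurable-B k with k ℕ.<? n
    ... | yes k<n = measurable-≐
      ((λ (a , eq) → a , trans (cong toℕ eq) (Fin.toℕ-fromℕ< k<n)) ,
       λ (a , eq) → a , Fin.toℕ-injective (trans eq (sym (Fin.toℕ-fromℕ< k<n))))
      (measurable-∩ mA (mPiece (fromℕ< k<n)))
    ... | no  k≮n = measurable-≐ ((λ ()) , λ {ω} b → ⊥-elim (B-empty k (ℕ.≮⇒≥ k≮n) ω b)) measurable-∅

    measurable-⋃B = measurable-⋃ B measurable-B

    ⋃B≐A : ⋃ ℕ B ≐ A
    ⋃B≐A = (λ (_ , a , _) → a) , λ a → _ , a , refl

    supremum = μ-⋃ B measurable-B (λ j≢k → λ ((_ , eq₁) , (_ , eq₂)) → j≢k (trans (sym eq₁) eq₂))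

    bounded : UpperBound (λ s → ∃[ m ] s ≡ sum {m} (λ k → μ (B (toℕ k)))) (sum {n} (λ j → μ (B (toℕ j))))
    bounded _ (m , refl) = sum-truncate m n (μ ∘ B) (μ-nonNegative ∘ measurable-B)
        (λ k n≤k → μ-empty (B-empty k n≤k))

  open SimpleFunction

  level : (s : SimpleFunction) → Fin (pieces s) → Pred Ω 0ℓ
  level s j ω = piece s ω ≡ j

  integralOn : Pred Ω 0ℓ → SimpleFunction → ℝ
  integralOn A s = sum (λ j → value s j * μ (A ∩ level s j))

  integralOn-partition : ∀ {A} → Measurable A → ∀ s t →
                         integralOn A t ≡ sum (λ j → integralOn (A ∩ level s j) t)
  integralOn-partition {A} mA s t = trans
    (sum-cong-≗ {pieces t} (λ l → trans
      (cong (value t l *_) (trans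
        (μ-partition (piece s) (measurable-∩ mA (measurable t l)) (measurable s))
        (sum-cong-≗ {pieces s} (λ j → μ-cong (measurable-∩ (measurable-∩ mA (measurable t l))
            (measurable s j))
          ((λ ((a , p) , q) → (a , q) , p) , λ ((a , q) , p) → (a , p) , q)))))
      (*-distribˡ-sum {pieces s} (value t l) _)))
    (∑-comm {pieces t} {pieces s} _)

  -- On the level set j the first function is the constant `value s j`, so the others sum to at most
  -- `c - value s j` there; adding over j restores `c * μ A`. The induction changes both the set and
  -- the bound, hence the general `A` and `c`.
  integralOn-sum-≤ : ∀ ss {A} c → Measurable A → (∀ ω → A ω → listSum (λ s → apply s ω) ss ≤ c) →
                     listSum (integralOn A) ss ≤ c * μ A
  integralOn-sum-≤ [] {A} c mA h with 0# ≤? c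
  ... | yes 0≤c = *-nonNegative 0≤c (μ-nonNegative mA)
  -- The bound can become negative only on a set without points, such as an empty level set of an
  -- earlier function.
  ... | no  0≰c = ≤-reflexive (sym (trans (cong (c *_) (μ-empty (λ ω a → 0≰c (h ω a)))) (zeroʳ c)))
  integralOn-sum-≤ (s ∷ ss) {A} c mA h = subst₂ _≤_ left right
    (sum-mono {pieces s} (λ j → +-monoʳ-≤ (value s j * μ (A ∩ level s j))
      (integralOn-sum-≤ ss (c - value s j) (measurable-∩ mA (measurable s j))
        (λ { ω (a , refl) → transfer (h ω a)
          (solve 3 (λ x v c → x :+ c := c :- v :+ (v :+ x)) refl _ (apply s ω) c) }))))
    where
    left : sum (λ j → value s j * μ (A ∩ level s j) + listSum (integralOn (A ∩ level s j)) ss) ≡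
           integralOn A s + listSum (integralOn A) ss
    left = trans (∑-distrib-+ {pieces s} _ _) (cong (integralOn A s +_) (sym (trans
      (listSum-cong (integralOn-partition mA s) ss)
      (listSum-sum {n = pieces s} (λ t j → integralOn (A ∩ level s j) t) ss))))
    right : sum (λ j → value s j * μ (A ∩ level s j) + (c - value s j) * μ (A ∩ level s j)) ≡ c * μ A
    right = trans
      (sum-cong-≗ {pieces s} (λ j → solve 3 (λ v m c → v :* m :+ (c :- v) :* m := c :* m) refl
          (value s j) _ c))
      (trans (sym (*-distribˡ-sum {pieces s} c _))
          (cong (c *_) (sym (μ-partition (piece s) mA (measurable s)))))

  integral-sum-≤ : ∀ ss c → (∀ ω → listSum (λ s → apply s ω) ss ≤ c) → listSum integral ss ≤ c
  integral-sum-≤ ss c h = subst₂ _≤_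
    (listSum-cong (λ s → sum-cong-≗ {pieces s} (λ j → cong (value s j *_)
      (sym (μ-cong (measurable s j) ((λ p → _ , p) , proj₂))))) ss)
    (trans (cong (c *_) μ-U) (*-identityʳ c))
    (integralOn-sum-≤ ss c measurable-U (λ ω _ → h ω))

  zeroFunction : SimpleFunction
  zeroFunction = record
    { pieces     = 1
    ; piece      = λ _ → zero
    ; value      = λ _ → 0#
    ; measurable = λ { zero → measurable-≐ ((λ _ → refl) , λ _ → _) measurable-U }
    }

  -- A supremum of integrals of simple functions from below is superadditive. The functions are
  -- traded one at a time for simple functions below them: in `mixed`, the list `ss` holds those
  -- already traded. This is what lets a bound for each fixed ω pass to the mean over arrival
  -- orders.
  expectation-sum-≤ : ∀ {I : Set} (f : I → Ω → ℝ) → (∀ i ω → 0# ≤ f i ω) → ∀ is c →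
                      (∀ ω → listSum (λ i → f i ω) is ≤ c) → listSum (expectation ∘ f) is ≤ c
  expectation-sum-≤ {I} f 0≤f is c h = subst (_≤ c) (+-identityˡ _)
    (mixed is [] (λ ω → subst (_≤ c) (sym (+-identityˡ _)) (h ω)))
    where
    mixed : ∀ is ss → (∀ ω → listSum (λ s → apply s ω) ss + listSum (λ i → f i ω) is ≤ c) →
            listSum integral ss + listSum (expectation ∘ f) is ≤ c
    mixed []       ss h = subst (_≤ c) (sym (+-identityʳ _))
      (integral-sum-≤ ss c (λ ω → subst (_≤ c) (+-identityʳ _) (h ω)))
    mixed (i ∷ is) ss h = transfer
      (proj₂ (sup-isSupremum _
          (_ , zeroFunction , (λ ω → ≤-refl , 0≤f i ω) , refl)
          (_ , bounded))
        _ bounded)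
      (solve 4 (λ e s r c → s :+ (e :+ r) :+ (c :- s :- r) := c :+ e) refl _ _ _ c)
      where
      bounded : UpperBound (λ v → Σ[ s ∈ SimpleFunction ] (∀ ω → 0# ≤ apply s ω × apply s ω ≤ f i ω) × v ≡
          integral s)
                  (c - listSum integral ss - listSum (expectation ∘ f) is)
      bounded _ (s , s≤f , refl) = transfer
        (mixed is (s ∷ ss) (λ ω → ≤-trans
          (transfer (proj₂ (s≤f ω)) (solve 4 (λ s x r f → s :+ x :+ r :+ f := x :+ (f :+ r) :+ s) refl _ _ _
              _))
          (h ω)))
        (solve 4 (λ v s r c → v :+ c := c :- s :- r :+ (v :+ s :+ r)) refl (integral s) _ _ c)

-- The one-point probability space, for deterministic players.

module PointSpace (em : ExcludedMiddle 0ℓ) (R : RealNumbers) where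
  open RealNumbers R
  open RealProperties R
  open Probability R

  private
    -- The Dirac measure; excluded middle gives it a value on every predicate, and every predicate
    -- is measurable.
    mass : Pred ⊤ 0ℓ → ℝ
    mass A = if does (em {A tt}) then 1# else 0#

    mass-∈ : ∀ {A : Pred ⊤ 0ℓ} → A tt → mass A ≡ 1#
    mass-∈ {A} a with em {A tt}
    ... | yes _ = refl
    ... | no ¬a = ⊥-elim (¬a a)

    mass-∉ : ∀ {A : Pred ⊤ 0ℓ} → ¬ A tt → mass A ≡ 0#
    mass-∉ {A} ¬a with em {A tt}
    ... | yes a = ⊥-elim (¬a a)
    ... | no _  = refl

    mass-nonNeg : ∀ (A : Pred ⊤ 0ℓ) → 0# ≤ mass A
    mass-nonNeg A with em {A tt}
    ... | yes _ = 0≤1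
    ... | no _  = ≤-refl

    sum-mass≡0 : ∀ m (A : ℕ → Pred ⊤ 0ℓ) → (∀ k → ¬ A k tt) → sum {m} (λ k → mass (A (toℕ k))) ≡ 0#
    sum-mass≡0 m A ¬a = trans (sum-cong-≗ {m} (λ k → mass-∉ (¬a (toℕ k)))) (trans (sum-const m 0#) (zeroʳ _))

    sum-mass≤1 : ∀ m (A : ℕ → Pred ⊤ 0ℓ) → (∀ {j k} → j ≢ k → A j ⊥ A k) →
                 sum {m} (λ k → mass (A (toℕ k))) ≤ 1#
    sum-mass≤1 zero    A dis = 0≤1
    sum-mass≤1 (suc m) A dis with em {A 0 tt}
    ... | yes a = ≤-reflexive (trans
      (cong (1# +_) (sum-mass≡0 m (A ∘ suc) (λ k b → dis {0} {suc k} (λ ()) (a , b)))) (+-identityʳ 1#))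
    ... | no ¬a = subst (_≤ 1#) (sym (+-identityˡ _))
        (sum-mass≤1 m (A ∘ suc) (λ j≢k → dis (j≢k ∘ ℕ.suc-injective)))

    sum-mass≥1 : ∀ k (A : ℕ → Pred ⊤ 0ℓ) → A k tt → 1# ≤ sum {suc k} (λ k → mass (A (toℕ k)))
    sum-mass≥1 zero    A a = ≤-reflexive (sym (trans (+-identityʳ _) (mass-∈ {A 0} a)))
    sum-mass≥1 (suc k) A a = ≤-trans (≤-reflexive (sym (+-identityˡ 1#)))
        (+-mono-≤ (mass-nonNeg (A 0)) (sum-mass≥1 k (A ∘ suc) a))

    mass-cong : ∀ {A B : Pred ⊤ 0ℓ} → A ≐ B → mass A ≡ mass B
    mass-cong {A} {B} (A⊆B , B⊆A) with em {A tt}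
    ... | yes a = sym (mass-∈ {B} (A⊆B a))
    ... | no ¬a = sym (mass-∉ {B} (¬a ∘ B⊆A))

  pointSpace : ProbabilitySpace
  pointSpace = record
    { Ω             = ⊤
    ; Measurable    = λ _ → ⊤
    ; μ             = mass
    ; measurable-≐  = λ _ _ → tt
    ; measurable-U  = tt
    ; measurable-∁  = λ _ → tt
    ; measurable-⋃  = λ _ _ → tt
    ; μ-cong        = λ _ A≐B → mass-cong A≐B
    ; μ-nonNegative = λ {A} _ → mass-nonNeg A
    ; μ-U           = mass-∈ {U} tt
    ; μ-⋃           = λ A _ dis → (λ { _ (m , refl) → upper A m dis }) , least A
    }
    where
    upper : ∀ (A : ℕ → Pred ⊤ 0ℓ) m → (∀ {j k} → j ≢ k → A j ⊥ A k) →
            sum {m} (λ k → mass (A (toℕ k))) ≤ mass (⋃ ℕ A)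
    upper A m dis with em {⋃ ℕ A tt}
    ... | yes _ = sum-mass≤1 m A dis
    ... | no ¬a = ≤-reflexive (sum-mass≡0 m A (λ k a → ¬a (k , a)))
    least : ∀ (A : ℕ → Pred ⊤ 0ℓ) b → UpperBound (λ s → ∃[ m ] s ≡ sum {m} (λ k → mass (A (toℕ k)))) b →
            mass (⋃ ℕ A) ≤ b
    least A b ub with em {⋃ ℕ A tt}
    ... | yes (k , a) = ≤-trans (sum-mass≥1 k A a) (ub _ (suc k , refl))
    ... | no _        = ub _ (0 , refl)

  open ProbabilitySpace pointSpace using (expectation; SimpleFunction)
  open SimpleFunction

  expectation-point : ∀ (f : ⊤ → ℝ) → 0# ≤ f tt → f tt ≤ expectation f
  expectation-point f 0≤f = proj₁ (sup-isSupremum _ (_ , member) (f tt , bounded)) (f tt) member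
    where
    constant : SimpleFunction
    constant = record { pieces = 1 ; piece = λ _ → zero ; value = λ _ → f tt ; measurable = λ _ → tt }
    member : Σ[ s ∈ SimpleFunction ] (∀ ω → 0# ≤ apply s ω × apply s ω ≤ f ω) × f tt ≡ integral s
    member = constant , (λ _ → 0≤f , ≤-refl) ,
      sym (trans (+-identityʳ _) (trans (cong (f tt *_) (mass-∈ refl)) (*-identityʳ _)))
    -- `sup` is specified only for bounded sets, so even a lower bound on the expectation requires
    -- an upper bound for the integrals.
    bounded : UpperBound (λ v → Σ[ s ∈ SimpleFunction ] (∀ ω → 0# ≤ apply s ω × apply s ω ≤ f ω) × v ≡
        integral s) (f tt)
    bounded _ (s , s≤f , refl) = subst (_≤ f tt) (+-identityʳ _)
      (Integration.integral-sum-≤ em R pointSpace (s ∷ []) (f tt)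
        (λ ω → subst (_≤ f tt) (sym (+-identityʳ _)) (proj₂ (s≤f ω))))

-- Counting the indices whose value satisfies a Boolean test.

module ℕSum = Algebra.Properties.CommutativeMonoid.Sum ℕ.+-0-commutativeMonoid

toℕᵇ : Bool → ℕ
toℕᵇ b = if b then 1 else 0

count : ∀ {A : Set} {n} → (A → Bool) → (Fin n → A) → ℕ
count p r = ℕSum.sum (toℕᵇ ∘ p ∘ r)

count-remove : ∀ {A : Set} {n} (p : A → Bool) (r : Fin (suc n) → A) i →
               count p r ≡ toℕᵇ (p (r i)) ℕ.+ count p (r ∘ punchIn i)
count-remove p r i = ℕSum.sum-remove {i = i} (toℕᵇ ∘ p ∘ r)

count-permute : ∀ {A : Set} {n} (p : A → Bool) (r : Fin n → A) (π : Permutation′ n) →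
                count p (Vec.lookup (Vec.tabulate (r ∘ (π ⟨$⟩ʳ_)))) ≡ count p r
count-permute p r π = trans
  (ℕSum.sum-cong-≗ (cong (toℕᵇ ∘ p) ∘ Vec.lookup∘tabulate (r ∘ (π ⟨$⟩ʳ_))))
  (sym (ℕSum.sum-permute (toℕᵇ ∘ p ∘ r) π))

toℕᵇ-mono : ∀ {a b} → (T a → T b) → toℕᵇ a ℕ.≤ toℕᵇ b
toℕᵇ-mono {false} _   = ℕ.z≤n
toℕᵇ-mono {true} {true}  _   = ℕ.≤-refl
toℕᵇ-mono {true} {false} a⇒b = ⊥-elim (a⇒b tt)

count-mono : ∀ {A : Set} {n} {p q : A → Bool} → (∀ x → T (p x) → T (q x)) → (r : Fin n → A) →
             count p r ℕ.≤ count q r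
count-mono {n = zero}  p⊆q r = ℕ.z≤n
count-mono {n = suc n} p⊆q r = ℕ.+-mono-≤ (toℕᵇ-mono (p⊆q (r zero))) (count-mono p⊆q (r ∘ suc))

count≤n : ∀ {A : Set} {n} (p : A → Bool) (r : Fin n → A) → count p r ℕ.≤ n
count≤n {n = zero}  p r = ℕ.z≤n
count≤n {n = suc n} p r = ℕ.+-mono-≤ (toℕᵇ-mono {b = true} _) (count≤n p (r ∘ suc))

count-pos : ∀ {A : Set} {n} (p : A → Bool) (r : Fin n → A) i → T (p (r i)) → 0 ℕ.< count p r
count-pos {n = suc n} p r i pi with p (r i) | count-remove p r i
... | true | eq rewrite eq = ℕ.s≤s ℕ.z≤n

-- Uniformly random order as successive removal, and ratios of counts.

module RandomOrder (R : RealNumbers) where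
  open RealNumbers R
  open RealProperties R
  open ListSums R

  listSum-map : ∀ {I J : Set} (f : J → ℝ) (g : I → J) xs → listSum f (map g xs) ≡ listSum (f ∘ g) xs
  listSum-map f g xs = cong (List.foldr _+_ 0#) (sym (List.map-∘ xs))

  listSum-++ : ∀ {I : Set} (f : I → ℝ) xs ys → listSum f (xs ++ ys) ≡ listSum f xs + listSum f ys
  listSum-++ f []       ys = sym (+-identityˡ _)
  listSum-++ f (x ∷ xs) ys = trans (cong (f x +_) (listSum-++ f xs ys)) (sym (+-assoc _ _ _))

  listSum-concatMap : ∀ {I J : Set} (f : J → ℝ) (g : I → List J) xs →
                      listSum f (concatMap g xs) ≡ listSum (listSum f ∘ g) xs
  listSum-concatMap f g []       = refl
  listSum-concatMap f g (x ∷ xs) = trans (listSum-++ f (g x) (concatMap g xs))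
      (cong (_ +_) (listSum-concatMap f g xs))

  listSum-tabulate : ∀ {I : Set} {n} (f : I → ℝ) (g : Fin n → I) → listSum f (List.tabulate g) ≡ sum (f ∘ g)
  listSum-tabulate {n = zero}  f g = refl
  listSum-tabulate {n = suc n} f g = cong (f (g zero) +_) (listSum-tabulate f (g ∘ suc))

  listSum-const : ∀ {I : Set} (b : ℝ) (xs : List I) → listSum (λ _ → b) xs ≡ fromℕ (length xs) * b
  listSum-const b []       = sym (zeroˡ b)
  listSum-const b (x ∷ xs) = trans (cong (b +_) (listSum-const b xs))
    (trans (cong (_+ fromℕ (length xs) * b) (sym (*-identityˡ b))) (sym (distribʳ b 1# (fromℕ (length xs)))))

  #permutations : ℕ → ℝ
  #permutations n = fromℕ (length (allPermutations n))

  -- The expectation over arrival orders before normalisation; the factor `#permutations` is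
  -- cancelled only at the very end, which keeps division out of the inductions.
  permSum : ∀ {A : Set} {n} → (Vec A n → ℝ) → (Fin n → A) → ℝ
  permSum {n = n} f r = listSum (λ π → f (Vec.tabulate (r ∘ (π ⟨$⟩ʳ_)))) (allPermutations n)

  private
    listSum-allPermutations : ∀ {n} (f : Permutation′ (suc n) → ℝ) → listSum f (allPermutations (suc n)) ≡
      sum (λ i → listSum (λ π → f (Perm.insert zero i π)) (allPermutations n))
    listSum-allPermutations {n} f = trans
        (listSum-concatMap f (λ i → map (Perm.insert zero i) (allPermutations n)) (allFin (suc n)))
      (trans (listSum-tabulate (λ i → listSum f (map (Perm.insert zero i) (allPermutations n))) id)
        (sum-cong-≗ (λ i → listSum-map f (Perm.insert zero i) (allPermutations n))))

  #permutations-suc : ∀ n → #permutations (suc n) ≡ fromℕ (suc n) * #permutations n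
  #permutations-suc n = trans (sym (count-all {suc n}))
      (trans (listSum-allPermutations (λ (π : Permutation′ (suc n)) → 1#))
    (trans (sum-cong-≗ {suc n} (λ _ → count-all {n})) (sum-const (suc n) (#permutations n))))
    where
    count-all : ∀ {n} → listSum (λ _ → 1#) (allPermutations n) ≡ #permutations n
    count-all {n} = trans (listSum-const 1# (allPermutations n)) (*-identityʳ _)

  0≤#permutations : ∀ n → 0# ≤ #permutations n
  0≤#permutations n = fromℕ-nonNeg (length (allPermutations n))

  0<#permutations : ∀ n → 0# < #permutations n
  0<#permutations zero    = fromℕ-pos 0
  0<#permutations (suc n) = subst (0# <_) (sym (#permutations-suc n))
      (*-pos (fromℕ-pos n) (0<#permutations n))

  -- Conditioning on the first arrival: `allPermutations` fixes the image i of zero, and what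
  -- remains is a uniformly random order of `r ∘ punchIn i`. Both backward inductions advance by
  -- this step.
  permSum-suc : ∀ {A : Set} {n} (f : Vec A (suc n) → ℝ) (r : Fin (suc n) → A) →
                permSum f r ≡ sum (λ i → permSum (λ v → f (r i ∷ v)) (r ∘ punchIn i))
  permSum-suc {n = n} f r = trans (listSum-allPermutations (λ π → f (Vec.tabulate (r ∘ (π ⟨$⟩ʳ_)))))
      (sum-cong-≗ {suc n} (λ i →
    listSum-cong (λ π → cong (λ v → f (r i ∷ v))
        (Vec.tabulate-cong (λ k → cong r (Perm.insert-punchIn zero i π k))))
      (allPermutations n)))

  permSum-cong : ∀ {A : Set} {n} {f g : Vec A n → ℝ} → (∀ v → f v ≡ g v) → ∀ r → permSum f r ≡ permSum g r
  permSum-cong {n = n} f≗g r = listSum-cong (λ π → f≗g _) (allPermutations n)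

  permSum-≤ : ∀ {A : Set} {n} (f : Vec A n → ℝ) r b →
      (∀ (π : Permutation′ n) → f (Vec.tabulate (r ∘ (π ⟨$⟩ʳ_))) ≤ b) →
              permSum f r ≤ #permutations n * b
  permSum-≤ {n = n} f r b f≤b = ≤-trans (listSum-mono f≤b (allPermutations n))
      (≤-reflexive (listSum-const b (allPermutations n)))

  permSum-≥ : ∀ {A : Set} {n} (f : Vec A n → ℝ) r b →
      (∀ (π : Permutation′ n) → b ≤ f (Vec.tabulate (r ∘ (π ⟨$⟩ʳ_)))) →
              #permutations n * b ≤ permSum f r
  permSum-≥ {n = n} f r b b≤f = ≤-trans (≤-reflexive (sym (listSum-const b (allPermutations n))))
      (listSum-mono b≤f (allPermutations n))

  indicator : Bool → ℝ
  indicator b = fromℕ (toℕᵇ b)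

  fromℕ-count : ∀ {A : Set} {n} (p : A → Bool) (r : Fin n → A) → fromℕ (count p r) ≡ sum (indicator ∘ p ∘ r)
  fromℕ-count {n = zero}  p r = refl
  fromℕ-count {n = suc n} p r = trans (fromℕ-+ (toℕᵇ (p (r zero))) _)
      (cong (indicator (p (r zero)) +_) (fromℕ-count p (r ∘ suc)))

  -- With the value 0 at k / 0 the ratio stays superharmonic when the last element
  -- counted by the denominator is removed.
  ratio : ℕ → ℕ → ℝ
  ratio k zero    = 0#
  ratio k (suc n) = fromℕ k / fromℕ (suc n)

  n*ratio : ∀ {k n} → k ℕ.≤ n → fromℕ n * ratio k n ≡ fromℕ k
  n*ratio {n = zero}  ℕ.z≤n = zeroʳ 0#
  n*ratio {n = suc n} k≤n   = x*[y/x]≡y _ (fromℕ-pos n)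

  ratio-nonNeg : ∀ k n → 0# ≤ ratio k n
  ratio-nonNeg k zero    = ≤-refl
  ratio-nonNeg k (suc n) = z*x≤y⇒z≤y/x (fromℕ-pos n) (subst (_≤ fromℕ k) (sym (zeroʳ _)) (fromℕ-nonNeg k))

  ratio≤1 : ∀ {k n} → k ℕ.≤ n → ratio k n ≤ 1#
  ratio≤1 {n = zero}      _   = 0≤1
  ratio≤1 {k} {n = suc n} k≤n = y≤z*x⇒y/x≤z (fromℕ-pos n)
      (subst (fromℕ k ≤_) (sym (*-identityʳ _)) (fromℕ-mono k≤n))

  -- n times the mean of the ratio after the removal of a uniformly random one of n
  -- elements, k of which are counted by the numerator.
  meanRatio : ℕ → ℕ → ℝ
  meanRatio k n = fromℕ k * ratio (ℕ.pred k) (ℕ.pred n) + (fromℕ n - fromℕ k) * ratio k (ℕ.pred n)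

  private
    meanRatio-suc : ∀ k n → meanRatio (suc k) (2 ℕ.+ n) ≡ fromℕ (suc k)
    meanRatio-suc k n = trans
      (solve 4 (λ o k t i → (o :+ k) :* (k :* i) :+ ((o :+ t) :- (o :+ k)) :* ((o :+ k) :* i) :=
         (o :+ k) :* (t :* i)) refl 1# (fromℕ k) (fromℕ (suc n)) (fromℕ (suc n) ⁻¹))
      (trans (cong (fromℕ (suc k) *_) (*-inverseʳ _ (<⇒≢ (fromℕ-pos n)))) (*-identityʳ _))

  -- The identity k (k - 1) + (n - k) k = k (n - 1). For k ≤ n it fails only at k = n = 1, where
  -- removing the one element sends the ratio from 1 to 0.
  meanRatio-< : ∀ {k n} → k ℕ.< n → meanRatio k n ≡ fromℕ k
  meanRatio-< {zero} {suc zero} _ = solve 1 (λ x → 0′ :* 0′ :+ (x :- 0′) :* 0′ := 0′) refl (fromℕ 1)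
  meanRatio-< {suc k} {suc zero} (ℕ.s≤s ())
  meanRatio-< {zero} {suc (suc n)} _ =
    solve 3 (λ t i a → 0′ :* a :+ (t :- 0′) :* (0′ :* i) := 0′) refl (fromℕ (2 ℕ.+ n)) (fromℕ (suc n) ⁻¹) _
  meanRatio-< {suc k} {suc (suc n)} _ = meanRatio-suc k n

  meanRatio-≤ : ∀ {k n} → k ℕ.≤ n → meanRatio k n ≤ fromℕ k
  meanRatio-≤ {zero}  {zero}  _ = ≤-reflexive (solve 0 (0′ :* 0′ :+ (0′ :- 0′) :* 0′ := 0′) refl)
  meanRatio-≤ {zero}  {suc n} _ = ≤-reflexive (meanRatio-< {zero} {suc n} (ℕ.s≤s ℕ.z≤n))
  meanRatio-≤ {suc k} {suc zero} _ = subst (_≤ fromℕ (suc k))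
    (solve 2 (λ k n → 0′ := k :* 0′ :+ (n :- k) :* 0′) refl (fromℕ (suc k)) (fromℕ 1)) (fromℕ-nonNeg (suc k))
  meanRatio-≤ {suc k} {suc (suc n)} _ = ≤-reflexive (meanRatio-suc k n)

  count-remove-∈ : ∀ {A : Set} {n} (p : A → Bool) (r : Fin (suc n) → A) i → T (p (r i)) →
                   count p (r ∘ punchIn i) ≡ ℕ.pred (count p r)
  count-remove-∈ p r i pi with p (r i) | count-remove p r i
  ... | true | eq = cong ℕ.pred (sym eq)

  count-remove-∉ : ∀ {A : Set} {n} (p : A → Bool) (r : Fin (suc n) → A) i → ¬ T (p (r i)) →
                   count p (r ∘ punchIn i) ≡ count p r
  count-remove-∉ p r i ¬pi with p (r i) | count-remove p r i
  ... | true  | eq = ⊥-elim (¬pi tt)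
  ... | false | eq = sym eq

  -- With k and t the two counts, the removed element is one of k in both, of t - k in the
  -- denominator only, or of the rest in neither. The first two kinds contribute `meanRatio k t`, at
  -- most k = t * (k / t), and the third leaves the ratio as it is.
  ratio-superharmonic : ∀ {A : Set} {n} {p q : A → Bool} → (∀ x → T (p x) → T (q x)) → (r : Fin (suc n) → A) →
    sum (λ i → ratio (count p (r ∘ punchIn i)) (count q (r ∘ punchIn i))) ≤
    fromℕ (suc n) * ratio (count p r) (count q r)
  ratio-superharmonic {A} {n} {p} {q} p⊆q r = ≤-trans (≤-reflexive total-sum) (transfer (meanRatio-≤ k≤t)
      (trans (cong (fromℕ k * a + (fromℕ t - fromℕ k) * b + (fromℕ (suc n) - fromℕ t) * c +_)
          (sym (n*ratio k≤t)))
        (solve 6 (λ k t N a b c → k :* a :+ (t :- k) :* b :+ (N :- t) :* c :+ t :* c :=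
           N :* c :+ (k :* a :+ (t :- k) :* b)) refl (fromℕ k) (fromℕ t) (fromℕ (suc n)) a b c)))
    where
    k = count p r
    t = count q r
    k≤t = count-mono p⊆q r
    a = ratio (ℕ.pred k) (ℕ.pred t)
    b = ratio k (ℕ.pred t)
    c = ratio k t
    P = indicator ∘ p ∘ r
    Q = indicator ∘ q ∘ r
    pointwise : ∀ i → ratio (count p (r ∘ punchIn i)) (count q (r ∘ punchIn i)) ≡
                P i * (a - b) + Q i * (b - c) + c
    pointwise i with p (r i) in eqp | q (r i) in eqq
    ... | true  | true  = trans
      (cong₂ ratio (count-remove-∈ p r i (subst T (sym eqp) tt))
          (count-remove-∈ q r i (subst T (sym eqq) tt)))
      (solve 3 (λ a b c → a := 1′ :* (a :- b) :+ 1′ :* (b :- c) :+ c) refl a b c)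
    ... | false | true  = trans
      (cong₂ ratio (count-remove-∉ p r i (subst T eqp)) (count-remove-∈ q r i (subst T (sym eqq) tt)))
      (solve 3 (λ a b c → b := 0′ :* (a :- b) :+ 1′ :* (b :- c) :+ c) refl a b c)
    ... | false | false = trans
      (cong₂ ratio (count-remove-∉ p r i (subst T eqp)) (count-remove-∉ q r i (subst T eqq)))
      (solve 3 (λ a b c → c := 0′ :* (a :- b) :+ 0′ :* (b :- c) :+ c) refl a b c)
    ... | true  | false = ⊥-elim (subst T eqq (p⊆q (r i) (subst T (sym eqp) tt)))
    total-sum : sum (λ i → ratio (count p (r ∘ punchIn i)) (count q (r ∘ punchIn i))) ≡
                fromℕ k * a + (fromℕ t - fromℕ k) * b + (fromℕ (suc n) - fromℕ t) * c
    total-sum = begin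
      _ ≡⟨ sum-cong-≗ {suc n} pointwise ⟩
      sum (λ i → P i * (a - b) + Q i * (b - c) + c)
        ≡⟨ ∑-distrib-+ {suc n} (λ i → P i * (a - b) + Q i * (b - c)) (λ _ → c) ⟩
      sum (λ i → P i * (a - b) + Q i * (b - c)) + sum {suc n} (λ _ → c)
        ≡⟨ cong₂ _+_ (∑-distrib-+ {suc n} (λ i → P i * (a - b)) (λ i → Q i * (b - c))) (sum-const (suc n) c) ⟩
      sum (λ i → P i * (a - b)) + sum (λ i → Q i * (b - c)) + fromℕ (suc n) * c
        ≡⟨ cong₂ (λ x y → x + y + fromℕ (suc n) * c)
             (trans (sym (*-distribʳ-sum {suc n} (a - b) P)) (cong (_* (a - b)) (sym (fromℕ-count p r))))
             (trans (sym (*-distribʳ-sum {suc n} (b - c) Q)) (cong (_* (b - c)) (sym (fromℕ-count q r)))) ⟩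
      fromℕ k * (a - b) + fromℕ t * (b - c) + fromℕ (suc n) * c
        ≡⟨ solve 6 (λ k t N a b c → k :* (a :- b) :+ t :* (b :- c) :+ N :* c :=
             k :* a :+ (t :- k) :* b :+ (N :- t) :* c) refl (fromℕ k) (fromℕ t) (fromℕ (suc n)) a b c ⟩
      _ ∎
      where open ≡-Reasoning

-- Elementary bounds on scores, and reduction of the expected score to fixed ω.

module PenTestingProperties (R : RealNumbers) where
  open RealNumbers R
  open RealProperties R
  open ListSums R
  open RandomOrder R
  open PenTesting R
  open NaturalMax (DecTotalOrder.totalOrder decTotalOrder)
    using (x≤y⇒x⊔y≈y; x≤y⇒y⊔x≈y; ⊔-lub; x≤y⊔x)
  open Extrema (DecTotalOrder.totalOrder decTotalOrder) using (xs≤max)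

  remaining-≤ : ∀ {x θ 0≤θ} → x ≤ θ → remaining x (finite θ 0≤θ) ≡ 0#
  remaining-≤ {x} {θ} x≤θ = x≤y⇒x⊔y≈y (transfer x≤θ (solve 2 (λ x t → x :- t :+ t := 0′ :+ x) refl x θ))

  remaining-> : ∀ {x θ 0≤θ} → θ ≤ x → remaining x (finite θ 0≤θ) ≡ x - θ
  remaining-> θ≤x = x≤y⇒y⊔x≈y (x≤y⇒0≤y-x θ≤x)

  remaining-nonNeg : ∀ x θ → 0# ≤ remaining x θ
  remaining-nonNeg x (finite θ _) = x≤y⊔x (x - θ) 0#
  remaining-nonNeg x ∞            = ≤-refl

  remaining-bounded : ∀ {x b} θ → x ≤ b → 0# ≤ b → remaining x θ ≤ b
  remaining-bounded {x} {b} (finite θ 0≤θ) x≤b 0≤b = ⊔-lub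
    (transfer (+-mono-≤ x≤b 0≤θ) (solve 3 (λ x t b → x :- t :+ (b :+ t) := b :+ (x :+ 0′)) refl x θ b)) 0≤b
  remaining-bounded ∞ _ 0≤b = 0≤b

  module _ {n} (P : Player n) (a : Vec ℝ n) where
    open Player P

    play-nonNeg : ∀ ω h {k} (xs : Vec ℝ k) → 0# ≤ play a ω h xs
    play-nonNeg ω h []       = ≤-refl
    play-nonNeg ω h (x ∷ xs) with accept a (test x (threshold a h ω) ∷ h) ω
    ... | true  = remaining-nonNeg x (threshold a h ω)
    ... | false = play-nonNeg ω _ xs

    play-bounded : ∀ ω h {k b} (xs : Vec ℝ k) → 0# ≤ b → (∀ i → Vec.lookup xs i ≤ b) → play a ω h xs ≤ b
    play-bounded ω h []       0≤b _ = 0≤b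
    play-bounded ω h (x ∷ xs) 0≤b xs≤b with accept a (test x (threshold a h ω) ∷ h) ω
    ... | true  = remaining-bounded (threshold a h ω) (xs≤b zero) 0≤b
    ... | false = play-bounded ω _ xs 0≤b (xs≤b ∘ suc)

    #permutations*expectedScore : #permutations n * expectedScore a ≡
      listSum (λ π → expectation (score a π)) (allPermutations n)
    #permutations*expectedScore = trans
      (cong (λ k → #permutations n * (listSum (λ π → expectation (score a π)) (allPermutations n) / fromℕ k))
        (List.length-map (λ π → expectation (score a π)) (allPermutations n)))
      (x*[y/x]≡y _ (0<#permutations n))

  module _ (em : ExcludedMiddle 0ℓ) {n} (P : Player n) (a : Vec ℝ n) where
    open Player P

    -- A randomized player is a mixture of deterministic ones, so it is enough to bound the average
    -- over arrival orders for each ω.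
    expectedScore-≤ : ∀ c → (∀ ω → permSum (play a ω []) (Vec.lookup a) ≤ #permutations n * c) →
        expectedScore a ≤ c
    expectedScore-≤ c h = *-cancelˡ-≤ (#permutations n) (0<#permutations n)
      (subst (_≤ _) (sym (#permutations*expectedScore P a))
        (Integration.expectation-sum-≤ em R space (score a)
            (λ π ω → play-nonNeg P a ω [] (Vec.tabulate (λ i → Vec.lookup a (π ⟨$⟩ʳ i))))
                (allPermutations n) _ h))

  lookup≤max : ∀ {n} (a : Vec ℝ n) i → Vec.lookup a i ≤ max 0# (Vec.toList a)
  lookup≤max a i = All.lookup (xs≤max 0# (Vec.toList a)) (∈-toList⁺ (∈-lookup i a))

-- Level counts of integer-valued instances.

ℕsum-++ : ∀ {m n} (f : Fin m → ℕ) (g : Fin n → ℕ) → ℕSum.sum (f Vector.++ g) ≡ ℕSum.sum f ℕ.+ ℕSum.sum g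
ℕsum-++ {zero}  f g = refl
ℕsum-++ {suc m} f g = trans (cong (f zero ℕ.+_) (trans
    (ℕSum.sum-cong-≗ shift) (ℕsum-++ (f ∘ suc) g)))
  (sym (ℕ.+-assoc (f zero) _ _))
  where
  shift : ∀ i → (f Vector.++ g) (suc i) ≡ ((f ∘ suc) Vector.++ g) i
  shift i with splitAt m i
  ... | inj₁ _ = refl
  ... | inj₂ _ = refl

count-++ : ∀ {A : Set} {m n} (p : A → Bool) (r : Fin m → A) (r′ : Fin n → A) →
           count p (r Vector.++ r′) ≡ count p r ℕ.+ count p r′
count-++ {m = m} p r r′ = trans (ℕSum.sum-cong-≗ push) (ℕsum-++ (toℕᵇ ∘ p ∘ r) (toℕᵇ ∘ p ∘ r′))
  where
  push : ∀ i → toℕᵇ (p ((r Vector.++ r′) i)) ≡ ((toℕᵇ ∘ p ∘ r) Vector.++ (toℕᵇ ∘ p ∘ r′)) i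
  push i with splitAt m i
  ... | inj₁ _ = refl
  ... | inj₂ _ = refl

count-const-true : ∀ {A : Set} {n} (p : A → Bool) (r : Fin n → A) → (∀ x → p x ≡ true) → count p r ≡ n
count-const-true {n = zero}  p r all = refl
count-const-true {n = suc n} p r all rewrite all (r zero) = cong suc (count-const-true p (r ∘ suc) all)

count-none : ∀ {A : Set} {n} (p : A → Bool) (r : Fin n → A) → (∀ i → ¬ T (p (r i))) → count p r ≡ 0
count-none {n = zero}  p r none = refl
count-none {n = suc n} p r none with p (r zero) | none zero
... | true  | ¬t = ⊥-elim (¬t tt)
... | false | _  = count-none p (r ∘ suc) (none ∘ suc)

atLeast : ∀ {J} → ℕ → Fin J → Bool
atLeast s x = s ≤ᵇ toℕ x

atLeast-suc : ∀ {J} s (x : Fin J) → atLeast (suc s) (suc x) ≡ atLeast s x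
atLeast-suc zero    x = refl
atLeast-suc (suc s) x = refl

atLeast-antitone : ∀ {J} s (x : Fin J) → T (atLeast (suc s) x) → T (atLeast s x)
atLeast-antitone s x t = ℕ.≤⇒≤ᵇ (ℕ.<⇒≤ (ℕ.≤ᵇ⇒≤ (suc s) (toℕ x) t))

#atLeast : ∀ {m J} → ℕ → (Fin m → Fin J) → ℕ
#atLeast s ℓ = count (atLeast s) ℓ

#atLeast-J : ∀ {m J s} (ℓ : Fin m → Fin J) → J ℕ.≤ s → #atLeast s ℓ ≡ 0
#atLeast-J {s = s} ℓ J≤s = count-none (atLeast s) ℓ
    (λ i t → ℕ.<⇒≱ (Fin.toℕ<n (ℓ i)) (ℕ.≤-trans J≤s (ℕ.≤ᵇ⇒≤ s _ t)))

-- The family for J, on exactly Q^J indices, is raised by one level and padded with level 0 up to n.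
-- Below the top level J of the result, level s ≥ 1 is thus reached by Q^(J - s) indices, and only
-- the count at level 0 depends on n.
geometricLevels : ∀ Q J n → 0 ℕ.< Q → Q ℕ.^ J ℕ.≤ n →
  Σ[ ℓ ∈ (Fin n → Fin (suc J)) ] (∃[ i ] toℕ (ℓ i) ≡ J) × (∀ s → Q ℕ.* #atLeast (suc s) ℓ ℕ.≤ #atLeast s ℓ)
geometricLevels Q zero    (suc n) 0<Q _ = (λ _ → zero) , (zero , refl) ,
  λ s → ℕ.≤-trans (ℕ.≤-reflexive (trans
    (cong (Q ℕ.*_) (#atLeast-J {suc n} {1} {suc s} (λ _ → zero) (ℕ.s≤s ℕ.z≤n))) (ℕ.*-zeroʳ Q))) ℕ.z≤n
geometricLevels Q (suc J) n 0<Q Q^J≤n with ℕ.m≤n⇒∃[o]m+o≡n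
    (ℕ.≤-trans (ℕ.^-monoʳ-≤ Q {{ℕ.>-nonZero 0<Q}} (ℕ.n≤1+n J)) Q^J≤n)
                                         | geometricLevels Q J (Q ℕ.^ J) 0<Q ℕ.≤-refl
... | d , refl | ℓ′ , (top , top≡J) , geometric = ℓ , (top F.↑ˡ d , top-level) , geometric′
  where
  ℓ : Fin (Q ℕ.^ J ℕ.+ d) → Fin (suc (suc J))
  ℓ = (suc ∘ ℓ′) Vector.++ (λ _ → zero)
  top-level : toℕ (ℓ (top F.↑ˡ d)) ≡ suc J
  top-level rewrite Fin.splitAt-↑ˡ (Q ℕ.^ J) top d = cong suc top≡J
  count-ℓ : ∀ s → #atLeast (suc s) ℓ ≡ #atLeast s ℓ′
  count-ℓ s = trans (count-++ (atLeast (suc s)) (suc ∘ ℓ′) (λ _ → zero))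
    (trans (cong₂ ℕ._+_ (ℕSum.sum-cong-≗ (λ i → cong toℕᵇ (atLeast-suc s (ℓ′ i))))
      (count-none {n = d} (atLeast {suc (suc J)} (suc s)) (λ _ → zero) (λ _ ())))
      (ℕ.+-identityʳ _))
  geometric′ : ∀ s → Q ℕ.* #atLeast (suc s) ℓ ℕ.≤ #atLeast s ℓ
  geometric′ zero    = subst₂ ℕ._≤_
    (cong (Q ℕ.*_) (sym (trans (count-ℓ 0) (count-const-true (atLeast 0) ℓ′ (λ _ → refl)))))
    (sym (count-const-true (atLeast 0) ℓ (λ _ → refl))) Q^J≤n
  geometric′ (suc s) = subst₂ (λ x y → Q ℕ.* x ℕ.≤ y) (sym (count-ℓ (suc s))) (sym (count-ℓ s)) (geometric s)

-- The subtraction is truncated, so each term is the number of levels s with t ≤ s ≤ ℓ i; the whole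
-- is the tail sum of `#atLeast s ℓ` over s ≥ t.
overshoot : ∀ {m J} → ℕ → (Fin m → Fin J) → ℕ
overshoot t ℓ = ℕSum.sum (λ i → suc (toℕ (ℓ i)) ℕ.∸ t)

overshoot-suc : ∀ {m J} t (ℓ : Fin m → Fin J) → overshoot t ℓ ≡ #atLeast t ℓ ℕ.+ overshoot (suc t) ℓ
overshoot-suc {m} t ℓ = trans (ℕSum.sum-cong-≗ {m} (λ i → pointwise t (toℕ (ℓ i)))) (ℕSum.∑-distrib-+ {m} _ _)
  where
  pointwise : ∀ t v → suc v ℕ.∸ t ≡ toℕᵇ (t ≤ᵇ v) ℕ.+ (suc v ℕ.∸ suc t)
  pointwise zero          v       = refl
  pointwise (suc zero)    zero    = refl
  pointwise (suc (suc t)) zero    = refl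
  pointwise (suc zero)    (suc v) = refl
  pointwise (suc (suc t)) (suc v) = pointwise (suc t) v

-- The tail sum is dominated by a geometric series of ratio 1 / 2. The induction runs downwards from
-- level J, from which on all counts vanish.
overshoot-≤ : ∀ {m J} (ℓ : Fin m → Fin J) → (∀ s → 2 ℕ.* #atLeast (suc s) ℓ ℕ.≤ #atLeast s ℓ) →
              ∀ t → overshoot t ℓ ℕ.≤ 2 ℕ.* #atLeast t ℓ
overshoot-≤ {m} {J} ℓ halving t = go J t (ℕ.m≤m+n J t)
  where
  go : ∀ f t → J ℕ.≤ f ℕ.+ t → overshoot t ℓ ℕ.≤ 2 ℕ.* #atLeast t ℓ
  go zero    t J≤t = ℕ.≤-trans (ℕ.≤-reflexive (trans
    (ℕSum.sum-cong-≗ {m} (λ i → ℕ.m≤n⇒m∸n≡0 (ℕ.≤-trans (Fin.toℕ<n (ℓ i)) J≤t)))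
        (ℕSum.sum-replicate-zero m))) ℕ.z≤n
  go (suc f) t J≤ = subst (ℕ._≤ 2 ℕ.* #atLeast t ℓ) (sym (overshoot-suc t ℓ)) (ℕ.+-monoʳ-≤ (#atLeast t ℓ)
    (ℕ.≤-trans (go f (suc t) (subst (J ℕ.≤_) (sym (ℕ.+-suc f t)) J≤))
      (ℕ.≤-trans (halving t) (ℕ.≤-reflexive (sym (ℕ.+-identityʳ _))))))

-- The lower bound on the competitive ratio.

module Hardness (em : ExcludedMiddle 0ℓ) (R : RealNumbers) (J : ℕ) where
  open RealNumbers R
  open RealProperties R
  open ListSums R
  open RandomOrder R
  open PenTesting R
  open PenTestingProperties R

  value : Fin (suc J) → ℝ
  value = fromℕ ∘ toℕ

  levelRatio : ∀ {m} → (Fin m → Fin (suc J)) → ℕ → ℝ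
  levelRatio ℓ s = ratio (#atLeast (suc s) ℓ) (#atLeast s ℓ)

  -- 2 bounds the gain from an acceptance as long as all level counts at least
  -- double; the sum bounds the probability that this ever fails (Doob), in which
  -- case the gain is at most J.
  potential : ∀ {m} → (Fin m → Fin (suc J)) → ℝ
  potential ℓ = fromℕ 2 + fromℕ J * (fromℕ 2 * sum {J} (λ s → levelRatio ℓ (toℕ s)))

  potential≥2 : ∀ {m} (ℓ : Fin m → Fin (suc J)) → fromℕ 2 ≤ potential ℓ
  potential≥2 ℓ = subst (_≤ potential ℓ) (+-identityʳ _) (+-monoʳ-≤ (fromℕ 2)
    (*-nonNegative (fromℕ-nonNeg J)
        (*-nonNegative (fromℕ-nonNeg 2)
            (sum-nonNeg {J} (λ s → ratio-nonNeg (#atLeast (suc (toℕ s)) ℓ) (#atLeast (toℕ s) ℓ))))))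

  potential-superharmonic : ∀ {m} (ℓ : Fin (suc m) → Fin (suc J)) →
    sum (λ i → potential (ℓ ∘ punchIn i)) ≤ fromℕ (suc m) * potential ℓ
  potential-superharmonic {m} ℓ = subst₂ _≤_ (sym left)
      (solve 3 (λ N J S → N :* 2′ :+ J :* (2′ :* (N :* S)) := N :* (2′ :+ J :* (2′ :* S))) refl
        (fromℕ (suc m)) (fromℕ J) (sum {J} (λ s → levelRatio ℓ (toℕ s))))
      (+-monoʳ-≤ (fromℕ (suc m) * fromℕ 2)
          (*-monoˡ-≤ (fromℕ J) (fromℕ-nonNeg J) (*-monoˡ-≤ (fromℕ 2) (fromℕ-nonNeg 2) ratios)))
    where
    ratioSum : Fin (suc m) → ℝ
    ratioSum i = sum {J} (λ s → levelRatio (ℓ ∘ punchIn i) (toℕ s))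
    ratios : sum ratioSum ≤ fromℕ (suc m) * sum {J} (λ s → levelRatio ℓ (toℕ s))
    ratios = ≤-trans (≤-reflexive (∑-comm {suc m} {J} (λ i s → levelRatio (ℓ ∘ punchIn i) (toℕ s))))
      (≤-trans (sum-mono {J} (λ s → ratio-superharmonic (atLeast-antitone (toℕ s)) ℓ))
        (≤-reflexive (sym (*-distribˡ-sum {J} (fromℕ (suc m)) (λ s → levelRatio ℓ (toℕ s))))))
    left : sum (λ i → potential (ℓ ∘ punchIn i)) ≡ fromℕ (suc m) * fromℕ 2 + fromℕ J * (fromℕ 2 *
             sum ratioSum)
    left = trans (∑-distrib-+ {suc m} (λ _ → fromℕ 2) (λ i → fromℕ J * (fromℕ 2 * ratioSum i)))
      (cong₂ _+_ (sum-const (suc m) (fromℕ 2))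
          (trans (sym (*-distribˡ-sum {suc m} (fromℕ J) (λ i → fromℕ 2 * ratioSum i)))
        (cong (fromℕ J *_) (sym (*-distribˡ-sum {suc m} (fromℕ 2) ratioSum)))))

  Halving : ∀ {m} → (Fin m → Fin (suc J)) → Set
  Halving ℓ = ∀ s → 2 ℕ.* #atLeast (suc s) ℓ ℕ.≤ #atLeast s ℓ

  -- At a level where the doubling fails the ratio exceeds 1 / 2, and this single term of the sum
  -- already contributes J.
  potential≥J : ∀ {m} (ℓ : Fin m → Fin (suc J)) → ¬ Halving ℓ → fromℕ J ≤ potential ℓ
  potential≥J ℓ ¬halving with em {∃[ s ] ¬ (2 ℕ.* #atLeast (suc s) ℓ ℕ.≤ #atLeast s ℓ)}
  ... | no none = ⊥-elim (¬halving (λ s → decidable-stable (2 ℕ.* #atLeast (suc s) ℓ ℕ.≤? #atLeast s ℓ)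
      (λ ¬p → none (s , ¬p))))
  ... | yes (s , ¬p) = ≤-trans (≤-reflexive (sym (*-identityʳ _))) (≤-trans
      (*-monoˡ-≤ (fromℕ J) (fromℕ-nonNeg J) (≤-trans half
        (*-monoˡ-≤ (fromℕ 2) (fromℕ-nonNeg 2) (subst (λ k → levelRatio ℓ k ≤ _) (Fin.toℕ-fromℕ< s<J)
          (term≤sum {J} (λ s → levelRatio ℓ (toℕ s))
              (λ s → ratio-nonNeg (#atLeast (suc (toℕ s)) ℓ) (#atLeast (toℕ s) ℓ)) (fromℕ< s<J))))))
      (transfer (fromℕ-nonNeg 2) (solve 2 (λ x t → x :+ t := t :+ x :+ 0′) refl _ (fromℕ 2))))
    where
    k = #atLeast (suc s) ℓ
    t = #atLeast s ℓ
    k≤t : k ℕ.≤ t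
    k≤t = count-mono (atLeast-antitone s) ℓ
    0<t : 0 ℕ.< t
    0<t = ℕ.n≢0⇒n>0 (λ t≡0 → ¬p (subst (ℕ._≤ t) (sym (cong (2 ℕ.*_) (ℕ.n≤0⇒n≡0 (subst (k ℕ.≤_) t≡0 k≤t))))
        ℕ.z≤n))
    s<J : s ℕ.< J
    s<J = ℕ.≰⇒> (λ J≤s → ¬p (subst (ℕ._≤ t) (sym (cong (2 ℕ.*_) (#atLeast-J ℓ (ℕ.s≤s J≤s)))) ℕ.z≤n))
    half : 1# ≤ fromℕ 2 * levelRatio ℓ s
    half = *-cancelˡ-≤ (fromℕ t) (fromℕ-pos′ 0<t) (subst₂ _≤_ (sym (*-identityʳ _))
      (trans (fromℕ-* 2 k) (trans (cong (fromℕ 2 *_) (sym (n*ratio k≤t)))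
        (solve 3 (λ a t r → a :* (t :* r) := t :* (a :* r)) refl (fromℕ 2) (fromℕ t) (levelRatio ℓ s))))
      (fromℕ-mono (ℕ.<⇒≤ (ℕ.≰⇒> ¬p))))

  -- What a passing value gains beyond the 2 granted by `potential`. Its sum over the unseen values
  -- is at most 0 exactly when the mean gain of the passing ones is at most 2, or none passes.
  excess : ℝ → Threshold → ℝ
  excess x (finite θ _) = if does (x ≤? θ) then 0# else x - θ - fromℕ 2
  excess x ∞            = 0#

  ⌊_⌋-below : ∀ θ → 0# ≤ θ → ∀ m → fromℕ m ≤ θ ⊎ ∃[ u ] fromℕ u ≤ θ × θ < fromℕ (suc u)
  ⌊ θ ⌋-below 0≤θ zero    = inj₁ 0≤θ
  ⌊ θ ⌋-below 0≤θ (suc m) with ⌊ θ ⌋-below 0≤θ m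
  ... | inj₂ found = inj₂ found
  ... | inj₁ m≤θ with fromℕ (suc m) ≤? θ
  ...   | yes p = inj₁ p
  ...   | no ¬p = inj₂ (m , m≤θ , ¬p)

  -- For u ≤ θ < u + 1 the values above θ are those of level at least u + 1, and each gains at most
  -- its distance from u. These distances add up to `overshoot (suc u) ℓ`, at most twice the number
  -- of such values.
  excess-sum≤0 : ∀ {m} (ℓ : Fin m → Fin (suc J)) → Halving ℓ → ∀ θ → sum (λ i → excess (value (ℓ i)) θ) ≤ 0#
  excess-sum≤0 {m} ℓ halving ∞ = ≤-reflexive (sum-replicate-zero m)
  excess-sum≤0 {m} ℓ halving (finite θ 0≤θ) with ⌊ θ ⌋-below 0≤θ J
  ... | inj₁ J≤θ = ≤-reflexive (trans (sum-cong-≗ {m} none) (sum-replicate-zero m))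
    where
    none : ∀ i → excess (value (ℓ i)) (finite θ 0≤θ) ≡ 0#
    none i with value (ℓ i) ≤? θ
    ... | yes _  = refl
    ... | no x≰θ = ⊥-elim (x≰θ (≤-trans (fromℕ-mono (Fin.toℕ≤pred[n] (ℓ i))) J≤θ))
  ... | inj₂ (u , u≤θ , θ<1+u) = ≤-trans (sum-mono {m} pointwise) (subst (_≤ 0#) (sym total-sum)
      (transfer (fromℕ-mono (overshoot-≤ ℓ halving (suc u)))
        (trans (cong (fromℕ (overshoot (suc u) ℓ) - fromℕ 2 * fromℕ (#atLeast (suc u) ℓ) +_)
            (fromℕ-* 2 (#atLeast (suc u) ℓ)))
          (solve 2 (λ o c → o :- c :+ c := 0′ :+ o) refl _ _))))
    where
    over : Fin m → ℕ
    over i = suc (toℕ (ℓ i)) ℕ.∸ suc u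
    pointwise : ∀ i → excess (value (ℓ i)) (finite θ 0≤θ) ≤ fromℕ (over i) - fromℕ 2 * indicator
        (atLeast (suc u) (ℓ i))
    pointwise i with value (ℓ i) ≤? θ | atLeast (suc u) (ℓ i) in eq
    ... | yes x≤θ | true  = ⊥-elim (θ<1+u
        (≤-trans (fromℕ-mono (ℕ.≤ᵇ⇒≤ (suc u) (toℕ (ℓ i)) (subst T (sym eq) tt))) x≤θ))
    ... | yes _   | false = transfer (fromℕ-nonNeg (over i))
        (solve 2 (λ o t → 0′ :+ o := o :- t :* 0′ :+ 0′) refl (fromℕ (over i)) (fromℕ 2))
    ... | no x≰θ  | false = ⊥-elim (x≰θ
        (≤-trans (fromℕ-mono {toℕ (ℓ i)} {u} (ℕ.≮⇒≥ (λ u<v → subst T eq (ℕ.≤⇒≤ᵇ u<v)))) u≤θ))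
    ... | no _    | true  = transfer u≤θ
        (trans (cong (λ v → v - θ - fromℕ 2 + θ) v≡)
          (solve 4 (λ u o θ t → u :+ o :- θ :- t :+ θ := o :- t :* 1′ :+ u) refl (fromℕ u)
              (fromℕ (over i)) θ (fromℕ 2)))
      where
      v≡ : value (ℓ i) ≡ fromℕ u + fromℕ (over i)
      v≡ = trans (cong fromℕ (sym (ℕ.m+[n∸m]≡n (ℕ.<⇒≤ (ℕ.≤ᵇ⇒≤ (suc u) (toℕ (ℓ i)) (subst T (sym eq) tt))))))
          (fromℕ-+ u (over i))
    total-sum : sum (λ i → fromℕ (over i) - fromℕ 2 * indicator (atLeast (suc u) (ℓ i))) ≡
                fromℕ (overshoot (suc u) ℓ) - fromℕ 2 * fromℕ (#atLeast (suc u) ℓ)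
    total-sum = go ℓ
      where
      go : ∀ {k} (ℓ : Fin k → Fin (suc J)) →
        sum (λ i → fromℕ (suc (toℕ (ℓ i)) ℕ.∸ suc u) - fromℕ 2 * indicator (atLeast (suc u) (ℓ i))) ≡
        fromℕ (overshoot (suc u) ℓ) - fromℕ 2 * fromℕ (#atLeast (suc u) ℓ)
      go {zero}  ℓ = solve 1 (λ t → 0′ := 0′ :- t :* 0′) refl (fromℕ 2)
      go {suc k} ℓ = trans (cong (fromℕ o - fromℕ 2 * fromℕ c +_) (go (ℓ ∘ suc)))
        (trans (solve 5 (λ o c O C t → o :- t :* c :+ (O :- t :* C) := (o :+ O) :- t :* (c :+ C)) refl
            (fromℕ o) (fromℕ c) _ _ (fromℕ 2))
          (cong₂ (λ x y → x - fromℕ 2 * y) (sym (fromℕ-+ o (overshoot (suc u) (ℓ ∘ suc))))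
              (sym (fromℕ-+ c (#atLeast (suc u) (ℓ ∘ suc))))))
        where
        o = suc (toℕ (ℓ zero)) ℕ.∸ suc u
        c = toℕᵇ (atLeast (suc u) (ℓ zero))

  module _ {n} (P : Player n) (a : Vec ℝ n) (ω : Player.Ω P) where
    open Player P

    -- A pass extends the history by `passed` whatever x is, so threshold and decision are the same
    -- for all passing x. This is where the hidden value enters the lower bound: the excesses may be
    -- summed over x under one common decision.
    excessIfAccepted : History → ℝ → ℝ
    excessIfAccepted h x = if accept a (passed ∷ h) ω then excess x (threshold a h ω) else 0#

    -- Here b bounds the continuation. A rejection is worth at most b, an acceptance after a failed
    -- test is worth 0, and one after a pass is worth x - θ = 2 + excess, which 2 ≤ b turns into b +
    -- excess.
    permSum-step-≤ : ∀ {m} h x (r : Fin m → ℝ) b → fromℕ 2 ≤ b →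
             (∀ h → permSum (play a ω h) r ≤ #permutations m * b) →
             permSum (λ v → play a ω h (x ∷ v)) r ≤ #permutations m * (b + excessIfAccepted h x)
    permSum-step-≤ {m} h x r b 2≤b ih = bound (threshold a h ω)
      where
      0≤b : 0# ≤ b
      0≤b = ≤-trans (fromℕ-nonNeg 2) 2≤b
      decide : ∀ acc h′ y {e} → (acc ≡ true → y ≤ b + e) → (acc ≡ false → 0# ≤ e) →
               permSum (λ v → if acc then y else play a ω h′ v) r ≤ #permutations m * (b + e)
      decide true  h′ y y≤ 0≤e = permSum-≤ (λ _ → y) r _ (λ _ → y≤ refl)
      decide false h′ y {e} y≤ 0≤e = ≤-trans (ih h′) (*-monoˡ-≤ _ (0≤#permutations m)
        (subst (_≤ b + e) (+-identityʳ b) (+-monoʳ-≤ b (0≤e refl))))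
      b≤b+0 : ∀ {y} → y ≡ 0# → y ≤ b + 0#
      b≤b+0 refl = subst (0# ≤_) (sym (+-identityʳ b)) 0≤b
      if-zero : ∀ (c : Bool) → (if c then 0# else 0#) ≡ 0#
      if-zero true  = refl
      if-zero false = refl
      bound : ∀ θ → permSum (λ v → if accept a (test x θ ∷ h) ω then remaining x θ else play a ω
          (test x θ ∷ h) v) r
                ≤ #permutations m * (b + (if accept a (passed ∷ h) ω then excess x θ else 0#))
      bound ∞ = ≤-trans (decide (accept a (failed x ∷ h) ω) (failed x ∷ h) 0# (λ _ → b≤b+0 refl)
          (λ _ → ≤-refl))
        (≤-reflexive (cong (λ e → #permutations m * (b + e)) (sym (if-zero (accept a (passed ∷ h) ω)))))
      bound (finite θ 0≤θ) with x ≤? θ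
      ... | yes x≤θ = ≤-trans
        (decide (accept a (failed x ∷ h) ω) (failed x ∷ h) (remaining x (finite θ 0≤θ))
          (λ _ → b≤b+0 (remaining-≤ {x} {θ} {0≤θ} x≤θ)) (λ _ → ≤-refl))
        (≤-reflexive (cong (λ e → #permutations m * (b + e)) (sym (if-zero (accept a (passed ∷ h) ω)))))
      ... | no x≰θ = decide (accept a (passed ∷ h) ω) (passed ∷ h) (remaining x (finite θ 0≤θ)) gain none
        where
        gain : accept a (passed ∷ h) ω ≡ true →
               remaining x (finite θ 0≤θ) ≤ b + (if accept a (passed ∷ h) ω then x - θ - fromℕ 2 else 0#)
        gain eq rewrite eq = ≤-trans (≤-reflexive (remaining-> {x} {θ} {0≤θ} (<⇒≤ x≰θ)))
          (transfer 2≤b (solve 4 (λ x θ t b → x :- θ :+ b := b :+ (x :- θ :- t) :+ t) refl x θ (fromℕ 2) b))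
        none : accept a (passed ∷ h) ω ≡ false →
            0# ≤ (if accept a (passed ∷ h) ω then x - θ - fromℕ 2 else 0#)
        none eq rewrite eq = ≤-refl

    -- Once the doubling has failed, the trivial bound J on the score suffices. Until then the mean
    -- over the first arrival is controlled by superharmonicity of the potential, and the excesses
    -- sum to at most 0.
    permSum-play-≤ : ∀ {m} (ℓ : Fin m → Fin (suc J)) h → permSum (play a ω h) (value ∘ ℓ) ≤ #permutations m
        * potential ℓ
    permSum-play-≤ {zero} ℓ h = permSum-≤ (play a ω h) (value ∘ ℓ) (potential ℓ)
        (λ _ → ≤-trans (fromℕ-nonNeg 2) (potential≥2 ℓ))
    permSum-play-≤ {suc m} ℓ h with em {Halving ℓ}
    ... | no ¬halving = permSum-≤ (play a ω h) (value ∘ ℓ) (potential ℓ) (λ π → ≤-trans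
      (play-bounded P a ω h (Vec.tabulate (value ∘ ℓ ∘ (π ⟨$⟩ʳ_))) (fromℕ-nonNeg J)
        (λ i → subst (_≤ fromℕ J) (sym (Vec.lookup∘tabulate (λ i → value (ℓ (π ⟨$⟩ʳ i))) i))
          (fromℕ-mono (Fin.toℕ≤pred[n] (ℓ (π ⟨$⟩ʳ i))))))
      (potential≥J ℓ ¬halving))
    ... | yes halving = begin
      permSum (play a ω h) (value ∘ ℓ)
        ≤⟨ ≤-reflexive (permSum-suc (play a ω h) (value ∘ ℓ)) ⟩
      sum (λ i → permSum (λ v → play a ω h (value (ℓ i) ∷ v)) (value ∘ ℓ ∘ punchIn i))
        ≤⟨ sum-mono {suc m} (λ i → permSum-step-≤ h (value (ℓ i)) (value ∘ ℓ ∘ punchIn i)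
            (potential (ℓ ∘ punchIn i))
             (potential≥2 (ℓ ∘ punchIn i)) (permSum-play-≤ (ℓ ∘ punchIn i))) ⟩
      sum (λ i → #permutations m * (potential (ℓ ∘ punchIn i) + excessIfAccepted h (value (ℓ i))))
        ≤⟨ ≤-reflexive (trans (sym (*-distribˡ-sum {suc m} (#permutations m)
               (λ i → potential (ℓ ∘ punchIn i) + excessIfAccepted h (value (ℓ i)))))
             (cong (#permutations m *_) (∑-distrib-+ {suc m} (λ i → potential (ℓ ∘ punchIn i))
                 (excessIfAccepted h ∘ value ∘ ℓ)))) ⟩
      #permutations m * (sum (λ i → potential (ℓ ∘ punchIn i)) + sum (λ i → excessIfAccepted h (value (ℓ i))))
        ≤⟨ *-monoˡ-≤ _ (0≤#permutations m)
            (+-mono-≤ (potential-superharmonic ℓ) (gain≤0 (accept a (passed ∷ h) ω))) ⟩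
      #permutations m * (fromℕ (suc m) * potential ℓ + 0#)
        ≤⟨ ≤-reflexive (trans
             (solve 3 (λ p k w → p :* (k :* w :+ 0′) := k :* p :* w) refl (#permutations m) (fromℕ (suc m))
                 (potential ℓ))
             (cong (_* potential ℓ) (sym (#permutations-suc m)))) ⟩
      #permutations (suc m) * potential ℓ ∎
      where
      gain≤0 : ∀ acc → sum (λ i → if acc then excess (value (ℓ i)) (threshold a h ω) else 0#) ≤ 0#
      gain≤0 true  = excess-sum≤0 ℓ halving (threshold a h ω)
      gain≤0 false = ≤-reflexive (sum-replicate-zero (suc m))
      open ≤-Reasoning using (begin_; step-≤; step-≡-⟩; _∎)

  private
    4′ : ∀ {n} → Solver.Polynomial n
    4′ = con (ℤ.+ 4)

  -- Each of the J ratios is at most 1 / Q, so J times their sum is at most J² / Q ≤ 1, and the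
  -- potential starts at no more than 2 + 2.
  initial-potential : ∀ {m} Q (ℓ : Fin m → Fin (suc J)) → J ℕ.* J ℕ.≤ Q →
      (∀ s → Q ℕ.* #atLeast (suc s) ℓ ℕ.≤ #atLeast s ℓ) →
                      potential ℓ ≤ fromℕ 4
  initial-potential Q ℓ J²≤Q geometric = transfer (*-monoˡ-≤ (fromℕ 2) (fromℕ-nonNeg 2) J*S≤1)
      (solve 2 (λ J S → 2′ :+ J :* (2′ :* S) :+ 2′ :* 1′ := 4′ :+ 2′ :* (J :* S)) refl (fromℕ J) S)
    where
    S = sum {J} (λ s → levelRatio ℓ (toℕ s))
    Q*ratio≤1 : ∀ s → fromℕ Q * levelRatio ℓ s ≤ 1#
    Q*ratio≤1 s with #atLeast s ℓ in eq
    ... | zero  = subst (_≤ 1#) (sym (zeroʳ _)) 0≤1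
    ... | suc t = *-cancelˡ-≤ (fromℕ (suc t)) (fromℕ-pos t) (subst₂ _≤_
      (trans (fromℕ-* Q k) (trans (cong (fromℕ Q *_) (sym (x*[y/x]≡y (fromℕ k) (fromℕ-pos t))))
        (solve 3 (λ q t r → q :* (t :* r) := t :* (q :* r)) refl (fromℕ Q) (fromℕ (suc t))
            (fromℕ k / fromℕ (suc t)))))
      (sym (*-identityʳ _))
      (fromℕ-mono (subst (Q ℕ.* k ℕ.≤_) eq (geometric s))))
      where k = #atLeast (suc s) ℓ
    Q*S≤J : fromℕ Q * S ≤ fromℕ J
    Q*S≤J = subst₂ _≤_ (sym (*-distribˡ-sum {J} (fromℕ Q) _)) (trans (sum-const J 1#) (*-identityʳ _))
      (sum-mono {J} (λ s → Q*ratio≤1 (toℕ s)))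
    0≤S : 0# ≤ S
    0≤S = sum-nonNeg {J} (λ s → ratio-nonNeg (#atLeast (suc (toℕ s)) ℓ) (#atLeast (toℕ s) ℓ))
    J*[J*S]≤J : fromℕ J * (fromℕ J * S) ≤ fromℕ J
    J*[J*S]≤J = ≤-trans (≤-reflexive (trans (sym (*-assoc _ _ S)) (cong (_* S) (sym (fromℕ-* J J)))))
      (≤-trans (*-monoʳ-≤ S 0≤S (fromℕ-mono J²≤Q)) Q*S≤J)
    J*S≤1 : fromℕ J * S ≤ fromℕ 1
    -- The estimate available is J * (J * S) ≤ J, which can be divided by J only if J is positive.
    J*S≤1 with J ℕ.≟ 0
    ... | yes J≡0 = subst (_≤ fromℕ 1) (sym (trans (cong (λ j → fromℕ j * S) J≡0) (zeroˡ S))) (fromℕ-nonNeg 1)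
    ... | no  J≢0 = *-cancelˡ-≤ (fromℕ J) (fromℕ-pos′ (ℕ.n≢0⇒n>0 J≢0))
      (≤-trans J*[J*S]≤J (≤-reflexive (solve 1 (λ j → j := j :* 1′) refl (fromℕ J))))

  hardInstance : ∀ {n} Q → 0 ℕ.< Q → J ℕ.* J ℕ.≤ Q → Q ℕ.^ J ℕ.≤ n → (P : Player n) (α : ℝ) →
                 P IsCompetitive α → fromℕ J ≤ fromℕ 4 * α
  hardInstance {n} Q 0<Q J²≤Q Q^J≤n P α (0<α , competitive) with geometricLevels Q J n 0<Q Q^J≤n
  ... | ℓ , (top , top≡J) , geometric = begin
      fromℕ J                              ≡⟨ cong fromℕ (sym top≡J) ⟩
      value (ℓ top)                        ≡⟨ sym (Vec.lookup∘tabulate (value ∘ ℓ) top) ⟩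
      Vec.lookup a top                     ≤⟨ lookup≤max a top ⟩
      M                                    ≡⟨ sym (x*[y/x]≡y M 0<α) ⟩
      α * (M / α)                          ≡⟨ solve 3 (λ α m i → α :* (m :* i) := α :* (i :* m)) refl α M
          (α ⁻¹) ⟩
      α * (α ⁻¹ * M)                       ≡⟨ cong (λ i → α * (i * M)) (sym (*-identityˡ (α ⁻¹))) ⟩
      α * (1# / α * M)                     ≤⟨ *-monoˡ-≤ α (<⇒≤ 0<α) (competitive a nonNeg) ⟩
      α * Player.expectedScore P a         ≤⟨ *-monoˡ-≤ α (<⇒≤ 0<α)
          (expectedScore-≤ em P a (fromℕ 4) score≤4) ⟩
      α * fromℕ 4                          ≡⟨ *-comm α _ ⟩
      fromℕ 4 * α                          ∎
    where
    open ≤-Reasoning using (begin_; step-≤; step-≡-⟩; _∎)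
    a : Vec ℝ n
    a = Vec.tabulate (value ∘ ℓ)
    M = max 0# (Vec.toList a)
    nonNeg : All (0# ≤_) a
    nonNeg = VecAll.tabulate⁺ (λ i → fromℕ-nonNeg (toℕ (ℓ i)))
    score≤4 : ∀ ω → permSum (Player.play P a ω []) (Vec.lookup a) ≤ #permutations n * fromℕ 4
    score≤4 ω = ≤-trans
      (≤-reflexive (listSum-cong (λ π → cong (Player.play P a ω [])
        (Vec.tabulate-cong (λ i → Vec.lookup∘tabulate (value ∘ ℓ) (π ⟨$⟩ʳ i)))) (allPermutations n)))
      (≤-trans (permSum-play-≤ P a ω ℓ [])
          (*-monoˡ-≤ _ (0≤#permutations n) (initial-potential Q ℓ J²≤Q geometric)))

-- The failure probability of the player and its decay.

Isolated : (ℕ → ℕ) → ℕ → Set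
Isolated c s = c (suc s) ≡ c s × 0 ℕ.< c s

IsolatedBelow : ℕ → (ℕ → ℕ) → Set
IsolatedBelow J c = ∃[ s ] s ℕ.< J × Isolated c s

IsolatedBelow-cong : ∀ {J c c′} → (∀ s → c s ≡ c′ s) → IsolatedBelow J c → IsolatedBelow J c′
IsolatedBelow-cong c≗c′ (s , s<J , eq , 0<cₛ) =
  s , s<J , trans (sym (c≗c′ (suc s))) (trans eq (c≗c′ s)) , subst (0 ℕ.<_) (c≗c′ s) 0<cₛ

module Survival (R : RealNumbers) where
  open RealNumbers R
  open RealProperties R
  open RandomOrder R

  -- The product of the 1 - ρ over the f levels from s upwards. Starting it at any s makes it depend
  -- only on counts at levels s and higher, so that removing a smaller value leaves it unchanged.
  survival : (ℕ → ℕ) → ℕ → ℕ → ℝ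
  survival c s zero    = 1#
  survival c s (suc f) = (1# - ratio (c (suc s)) (c s)) * survival c (suc s) f

  survival-cong : ∀ {c c′} s f → (∀ s′ → s ℕ.≤ s′ → c s′ ≡ c′ s′) → survival c s f ≡ survival c′ s f
  survival-cong s zero    _    = refl
  survival-cong s (suc f) c≗c′ = cong₂ _*_
    (cong₂ (λ k t → 1# - ratio k t) (c≗c′ (suc s) (ℕ.n≤1+n s)) (c≗c′ s ℕ.≤-refl))
    (survival-cong (suc s) f (λ s′ s<s′ → c≗c′ s′ (ℕ.<⇒≤ s<s′)))

  survival-zero : ∀ s f → survival (λ _ → 0) s f ≡ 1#
  survival-zero s zero    = refl
  survival-zero s (suc f) = trans (cong ((1# - 0#) *_) (survival-zero (suc s) f))
    (trans (*-identityʳ _) (solve 1 (λ o → o :- 0′ := o) refl 1#))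

  1-ratio-nonNeg : ∀ {k t} → k ℕ.≤ t → 0# ≤ 1# - ratio k t
  1-ratio-nonNeg k≤t = x≤y⇒0≤y-x (ratio≤1 k≤t)

  survival-nonNeg : ∀ {c} → (∀ s → c (suc s) ℕ.≤ c s) → ∀ s f → 0# ≤ survival c s f
  survival-nonNeg anti s zero    = 0≤1
  survival-nonNeg anti s (suc f) = *-nonNegative (1-ratio-nonNeg (anti s)) (survival-nonNeg anti (suc s) f)

  -- β counts the steep levels, where c falls by a factor of at least q, and γ the others, each of
  -- which multiplies the product by at most 1 - 1 / q. The bound q / (q + γ) for (1 - 1 / q)^γ is
  -- of Bernoulli type; it survives one more factor since (q - 1) (q + γ + 1) ≤ q (q + γ).
  survival-decay : ∀ q {c} → 0 ℕ.< q → (∀ s → c (suc s) ℕ.≤ c s) → ∀ s f → 0 ℕ.< c (s ℕ.+ f) →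
    ∃[ β ] ∃[ γ ] β ℕ.+ γ ≡ f × q ℕ.^ β ℕ.≤ c s × survival c s f * fromℕ (q ℕ.+ γ) ≤ fromℕ q
  survival-decay q {c} 0<q anti s zero 0<c = 0 , 0 , refl , subst (λ t → 1 ℕ.≤ c t) (ℕ.+-identityʳ s) 0<c ,
    ≤-reflexive (trans (*-identityˡ _) (cong fromℕ (ℕ.+-identityʳ q)))
  survival-decay q {c} 0<q anti s (suc f) 0<c
    with survival-decay q {c} 0<q anti (suc s) f (subst (λ t → 0 ℕ.< c t) (ℕ.+-suc s f) 0<c) | q ℕ.* c
        (suc s) ℕ.≤? c s
  ... | β , γ , refl , q^β≤ , bound | yes steep = suc β , γ , refl , ℕ.≤-trans (ℕ.*-monoʳ-≤ q q^β≤) steep ,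
    ≤-trans (*-monoʳ-≤ _ (fromℕ-nonNeg (q ℕ.+ γ)) (transfer
      (*-nonNegative (ratio-nonNeg (c (suc s)) (c s)) (survival-nonNeg anti (suc s) f))
      (trans (cong (_+ ρ * Φ) (trans (distribʳ Φ 1# (- ρ)) (cong (_+ (- ρ) * Φ) (*-identityˡ Φ))))
        (solve 2 (λ ρ Φ → Φ :+ (:- ρ) :* Φ :+ ρ :* Φ := Φ :+ 0′) refl ρ Φ)))) bound
    where
    ρ = ratio (c (suc s)) (c s)
    Φ = survival c (suc s) f
  ... | β , γ , refl , q^β≤ , bound | no flat = β , suc γ , ℕ.+-suc β γ , ℕ.≤-trans q^β≤ (anti s) ,
    *-cancelˡ-≤ (fromℕ q) (fromℕ-pos′ 0<q) (begin
      Q * ((1# - ρ) * Φ * fromℕ (q ℕ.+ suc γ))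
        ≡⟨ cong (λ x → Q * ((1# - ρ) * Φ * x)) (trans (fromℕ-+ q (suc γ)) refl) ⟩
      Q * ((1# - ρ) * Φ * (Q + (1# + fromℕ γ)))
        ≡⟨ solve 5 (λ Q ρ Φ o γ → Q :* ((o :- ρ) :* Φ :* (Q :+ (o :+ γ))) := (Q :* o :- Q :* ρ) :*
            (Φ :* (Q :+ (o :+ γ)))) refl Q ρ Φ 1# (fromℕ γ) ⟩
      (Q * 1# - Q * ρ) * (Φ * (Q + (1# + fromℕ γ)))
        ≤⟨ *-monoʳ-≤ _ (*-nonNegative 0≤Φ (+-nonNeg (fromℕ-nonNeg q) (fromℕ-nonNeg (suc γ))))
             (transfer 1≤Q*ρ (solve 3 (λ Q o x → Q :* o :- x :+ x := Q :* o :- o :+ o) refl Q 1# (Q * ρ))) ⟩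
      (Q * 1# - 1#) * (Φ * (Q + (1# + fromℕ γ)))
        ≤⟨ transfer (*-nonNegative 0≤Φ (fromℕ-nonNeg (suc γ)))
             (trans (cong (λ o → (Q * 1# - o) * (Φ * (Q + (o + fromℕ γ))) + Φ * (o + fromℕ γ)) (sym fromℕ-1))
               (trans (cong (λ x → (x - fromℕ 1) * (Φ * (Q + (fromℕ 1 + fromℕ γ))) + Φ *
                   (fromℕ 1 + fromℕ γ)) (*-identityʳ Q))
                 (solve 3 (λ Q Φ γ → (Q :- 1′) :* (Φ :* (Q :+ (1′ :+ γ))) :+ Φ :* (1′ :+ γ) := Q :*
                     (Φ :* (Q :+ γ)) :+ 0′) refl Q Φ (fromℕ γ)))) ⟩
      Q * (Φ * (Q + fromℕ γ))
        ≡⟨ cong (λ x → Q * (Φ * x)) (sym (fromℕ-+ q γ)) ⟩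
      Q * (Φ * fromℕ (q ℕ.+ γ))
        ≤⟨ *-monoˡ-≤ Q (fromℕ-nonNeg q) bound ⟩
      Q * Q ∎)
    where
    open ≤-Reasoning using (begin_; step-≤; step-≡-⟩; _∎)
    Q = fromℕ q
    k = c (suc s)
    t = c s
    ρ = ratio k t
    Φ = survival c (suc s) f
    0≤Φ = survival-nonNeg anti (suc s) f
    +-nonNeg : ∀ {x y} → 0# ≤ x → 0# ≤ y → 0# ≤ x + y
    +-nonNeg {x} {y} 0≤x 0≤y = subst (_≤ x + y) (+-identityʳ 0#) (+-mono-≤ 0≤x 0≤y)
    0<t : 0 ℕ.< t
    0<t = ℕ.n≢0⇒n>0 (λ t≡0 → flat (subst (ℕ._≤ t)
      (sym (trans (cong (q ℕ.*_) (ℕ.n≤0⇒n≡0 (subst (k ℕ.≤_) t≡0 (anti s)))) (ℕ.*-zeroʳ q))) ℕ.z≤n))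
    1≤Q*ρ : 1# ≤ Q * ρ
    1≤Q*ρ = *-cancelˡ-≤ (fromℕ t) (fromℕ-pos′ 0<t) (subst₂ _≤_ (sym (*-identityʳ _))
      (trans (fromℕ-* q k) (trans (cong (Q *_) (sym (n*ratio (anti s))))
        (solve 3 (λ q t r → q :* (t :* r) := t :* (q :* r)) refl Q (fromℕ t) ρ)))
      (fromℕ-mono (ℕ.<⇒≤ (ℕ.≰⇒> flat))))

  -- Fewer than q^(B + 1) values leave room for at most B steep levels, so γ ≥ q and q / (q + γ) ≤ 1
  -- / 2.
  survival≤½ : ∀ q B {c} → 1 ℕ.< q → (∀ s → c (suc s) ℕ.≤ c s) → 0 ℕ.< c (B ℕ.+ q) → c 0 ℕ.< q ℕ.^ suc B →
               survival c 0 (B ℕ.+ q) * fromℕ 2 ≤ fromℕ 1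
  survival≤½ q B {c} 1<q anti 0<c small
    with survival-decay q {c} (ℕ.<⇒≤ 1<q) anti 0 (B ℕ.+ q) 0<c
  ... | β , γ , β+γ≡B+q , q^β≤ , bound = *-cancelˡ-≤ (fromℕ q) (fromℕ-pos′ (ℕ.<⇒≤ 1<q)) (begin
      fromℕ q * (Φ * fromℕ 2)     ≡⟨ trans (solve 3 (λ q Φ t → q :* (Φ :* t) := Φ :* (t :* q)) refl
          (fromℕ q) Φ (fromℕ 2)) (cong (Φ *_) (sym (fromℕ-* 2 q))) ⟩
      Φ * fromℕ (2 ℕ.* q)         ≤⟨ *-monoˡ-≤ Φ (survival-nonNeg anti 0 (B ℕ.+ q)) (fromℕ-mono
                                        (ℕ.+-monoʳ-≤ q (subst (ℕ._≤ γ) (sym (ℕ.+-identityʳ q)) q≤γ))) ⟩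
      Φ * fromℕ (q ℕ.+ γ)         ≤⟨ bound ⟩
      fromℕ q                     ≡⟨ solve 1 (λ q → q := q :* 1′) refl (fromℕ q) ⟩
      fromℕ q * fromℕ 1           ∎)
    where
    open ≤-Reasoning using (begin_; step-≤; step-≡-⟩; _∎)
    Φ = survival c 0 (B ℕ.+ q)
    β≤B : β ℕ.≤ B
    β≤B = ℕ.≮⇒≥ (λ B<β → ℕ.<⇒≱ small (ℕ.≤-trans (ℕ.^-monoʳ-≤ q {{ℕ.>-nonZero (ℕ.<⇒≤ 1<q)}} B<β) q^β≤))
    q≤γ : q ℕ.≤ γ
    q≤γ = ℕ.+-cancelˡ-≤ B q γ (subst (ℕ._≤ B ℕ.+ γ) β+γ≡B+q (ℕ.+-monoˡ-≤ γ β≤B))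

-- The player for the upper bound and its guarantee.

module Algorithm (em : ExcludedMiddle 0ℓ) (R : RealNumbers) (J : ℕ) where
  open RealNumbers R
  open RealProperties R
  open ListSums R
  open RandomOrder R
  open PenTesting R
  open PenTestingProperties R
  open Probability R
  open Survival R
  open PointSpace em R

  module Levels (g : ℝ) (0≤g : 0# ≤ g) where
    above : ℕ → ℝ → Bool
    above s x = not (does (x ≤? fromℕ s * g))

    counts : ∀ {m} → (Fin m → ℝ) → ℕ → ℕ
    counts r s = count (above s) r

    ≤⇒¬above : ∀ {s x} → x ≤ fromℕ s * g → ¬ T (above s x)
    ≤⇒¬above {s} {x} x≤ with x ≤? fromℕ s * g
    ... | yes _ = id
    ... | no x≰ = λ _ → x≰ x≤

    >⇒above : ∀ {s x} → fromℕ s * g < x → T (above s x)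
    >⇒above {s} {x} x> with x ≤? fromℕ s * g
    ... | yes x≤ = ⊥-elim (x> x≤)
    ... | no _   = tt

    above⇒> : ∀ {s x} → T (above s x) → fromℕ s * g < x
    above⇒> {s} t x≤ = ≤⇒¬above {s} x≤ t

    level-mono : ∀ {s s′} → s ℕ.≤ s′ → fromℕ s * g ≤ fromℕ s′ * g
    level-mono s≤s′ = *-monoʳ-≤ g 0≤g (fromℕ-mono s≤s′)

    above-antitone : ∀ {s s′} → s ℕ.≤ s′ → ∀ x → T (above s′ x) → T (above s x)
    above-antitone {s} {s′} s≤s′ x t = >⇒above {s} (≤-<-trans (level-mono s≤s′) (above⇒> {s′} t))

    counts-antitone : ∀ {m} (r : Fin m → ℝ) s → counts r (suc s) ℕ.≤ counts r s
    counts-antitone r s = count-mono (above-antitone (ℕ.n≤1+n s)) r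

    -- Removing a value at or below level 0 changes nothing, so the claim reduces to the values
    -- above level 0, the case s = 0 of `weighted`. Excluding isolated levels rules out in
    -- particular c (s + 1) = c s = 1, where a removal would raise the factor of level s from 0 to
    -- 1.
    survival-superharmonic : ∀ {m} (r : Fin (suc m) → ℝ) → ¬ IsolatedBelow J (counts r) →
      sum (λ i → survival (counts (r ∘ punchIn i)) 0 J) ≤ fromℕ (suc m) * survival (counts r) 0 J
    survival-superharmonic {m} r none = ≤-trans (≤-reflexive split-sum)
      (transfer (weighted J 0 refl)
        (solve 4 (λ A t N Φ → A :+ (N :* Φ :- t :* Φ) :+ t :* Φ := N :* Φ :+ A) refl _ (fromℕ (c 0))
            (fromℕ (suc m)) (survival c 0 J)))
      where
      c = counts r
      c- : Fin (suc m) → ℕ → ℕ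
      c- i = counts (r ∘ punchIn i)

      unchanged : ∀ i s f → ¬ T (above s (r i)) → survival (c- i) s f ≡ survival c s f
      unchanged i s f ¬a = survival-cong s f
          (λ s′ s≤s′ → count-remove-∉ (above s′) r i (¬a ∘ above-antitone s≤s′ (r i)))

      mean : ∀ s → s ℕ.< J → meanRatio (c (suc s)) (c s) ≡ fromℕ (c (suc s))
      mean s s<J with c (suc s) ℕ.<? c s
      ... | yes k<t = meanRatio-< k<t
      ... | no  k≮t = subst₂ (λ k t → meanRatio k t ≡ fromℕ k) (sym (trans k≡t t≡0)) (sym t≡0)
        (solve 0 (0′ :* 0′ :+ (0′ :- 0′) :* 0′ := 0′) refl)
        where
        k≡t : c (suc s) ≡ c s
        k≡t = ℕ.≤-antisym (counts-antitone r s) (ℕ.≮⇒≥ k≮t)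
        t≡0 : c s ≡ 0
        t≡0 = ℕ.n≤0⇒n≡0 (ℕ.≮⇒≥ (λ 0<t → none (s , s<J , k≡t , 0<t)))

      -- The values above s that lie above s + 1 change the factor of level s to α and fall under
      -- the recursive call; those in between change only that factor, to β. The weighted sum of the
      -- two cases is φ * (t - `meanRatio k t`), and the mean ratio identity closes the step.
      weighted : ∀ f s → s ℕ.+ f ≡ J →
                 sum (λ i → indicator (above s (r i)) * survival (c- i) s f) ≤ fromℕ (c s) * survival c s f
      weighted zero s _ = ≤-reflexive
          (trans (sym (*-distribʳ-sum {suc m} 1# (λ i → indicator (above s (r i)))))
        (cong (_* 1#) (sym (fromℕ-count (above s) r))))
      weighted (suc f) s s+f≡J = begin
          sum (λ i → Q i * survival (c- i) s (suc f))
            ≡⟨ sum-cong-≗ {suc m} pointwise ⟩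
          sum (λ i → X i * α + (Q i * (φ * β) + P i * (- (φ * β))))
            ≡⟨ ∑-distrib-+ {suc m} (λ i → X i * α) (λ i → Q i * (φ * β) + P i * (- (φ * β))) ⟩
          sum (λ i → X i * α) + sum (λ i → Q i * (φ * β) + P i * (- (φ * β)))
            ≡⟨ cong₂ _+_ (sym (*-distribʳ-sum {suc m} α X))
                 (trans (∑-distrib-+ {suc m} (λ i → Q i * (φ * β)) (λ i → P i * (- (φ * β))))
                   (cong₂ _+_ (sum-indicator s (φ * β)) (sum-indicator (suc s) (- (φ * β))))) ⟩
          sum X * α + (fromℕ t * (φ * β) + fromℕ k * (- (φ * β)))
            ≤⟨ +-monoˡ-≤ _ (*-monoʳ-≤ α (1-ratio-nonNeg (ℕ.pred-mono-≤ k≤t))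
                (weighted f (suc s) (trans (sym (ℕ.+-suc s f)) s+f≡J))) ⟩
          fromℕ k * φ * α + (fromℕ t * (φ * β) + fromℕ k * (- (φ * β)))
            ≡⟨ solve 6 (λ k t φ a b o → k :* φ :* (o :- a) :+
                (t :* (φ :* (o :- b)) :+ k :* (:- (φ :* (o :- b)))) :=
                 φ :* (t :* o :- (k :* a :+ (t :- k) :* b))) refl (fromℕ k) (fromℕ t) φ _ _ 1# ⟩
          φ * (fromℕ t * 1# - meanRatio k t)
            ≡⟨ cong (λ x → φ * (fromℕ t * 1# - x)) (trans (mean s s<J) (sym (n*ratio k≤t))) ⟩
          φ * (fromℕ t * 1# - fromℕ t * ratio k t)
            ≡⟨ solve 4 (λ φ t o ρ → φ :* (t :* o :- t :* ρ) := t :* ((o :- ρ) :* φ)) refl φ (fromℕ t) 1#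
                (ratio k t) ⟩
          fromℕ t * ((1# - ratio k t) * φ) ∎
        where
        open ≤-Reasoning using (begin_; step-≤; step-≡-⟩; _∎)
        k = c (suc s)
        t = c s
        k≤t = counts-antitone r s
        s<J : s ℕ.< J
        s<J = subst (suc s ℕ.≤_) (trans (sym (ℕ.+-suc s f)) s+f≡J) (ℕ.m≤m+n (suc s) f)
        φ = survival c (suc s) f
        α = 1# - ratio (ℕ.pred k) (ℕ.pred t)
        β = 1# - ratio k (ℕ.pred t)
        P Q X : Fin (suc m) → ℝ
        P i = indicator (above (suc s) (r i))
        Q i = indicator (above s (r i))
        X i = P i * survival (c- i) (suc s) f
        sum-indicator : ∀ s x → sum (λ i → indicator (above s (r i)) * x) ≡ fromℕ (c s) * x
        sum-indicator s x = trans (sym (*-distribʳ-sum {suc m} x (λ i → indicator (above s (r i)))))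
          (cong (_* x) (sym (fromℕ-count (above s) r)))
        pointwise : ∀ i → Q i * survival (c- i) s (suc f) ≡ X i * α + (Q i * (φ * β) + P i * (- (φ * β)))
        pointwise i with above s (r i) in eqQ | above (suc s) (r i) in eqP
        ... | true  | true  = trans
          (cong₂ (λ k t → fromℕ 1 * ((1# - ratio k t) * survival (c- i) (suc s) f))
            (count-remove-∈ (above (suc s)) r i (subst T (sym eqP) tt))
                (count-remove-∈ (above s) r i (subst T (sym eqQ) tt)))
          (solve 3 (λ α x y → 1′ :* (α :* x) := 1′ :* x :* α :+ (1′ :* y :+ 1′ :* (:- y))) refl α _ (φ * β))
        ... | true  | false = trans
          (cong₂ (λ ρ x → fromℕ 1 * ((1# - ρ) * x))
            (cong₂ ratio (count-remove-∉ (above (suc s)) r i (subst T eqP))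
                (count-remove-∈ (above s) r i (subst T (sym eqQ) tt)))
            (unchanged i (suc s) f (subst T eqP)))
          (solve 4 (λ α x φ β → 1′ :* (β :* φ) := 0′ :* x :* α :+ (1′ :* (φ :* β) :+ 0′ :* (:- (φ :* β))))
              refl α _ φ β)
        ... | false | false = solve 4 (λ x y α z → 0′ :* x := 0′ :* y :* α :+ (0′ :* z :+ 0′ :* (:- z)))
            refl _ _ α (φ * β)
        ... | false | true  = ⊥-elim (subst T eqQ (above-antitone (ℕ.n≤1+n s) (r i) (subst T (sym eqP) tt)))

      split-sum : sum (λ i → survival (c- i) 0 J) ≡
              sum (λ i → indicator (above 0 (r i)) * survival (c- i) 0 J) +
                  (fromℕ (suc m) * survival c 0 J - fromℕ (c 0) * survival c 0 J)
      split-sum = trans (sum-cong-≗ {suc m} pointwise) (trans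
        (∑-distrib-+ {suc m} (λ i → indicator (above 0 (r i)) * survival (c- i) 0 J)
          (λ i → survival c 0 J + indicator (above 0 (r i)) * (- survival c 0 J)))
        (cong (sum (λ i → indicator (above 0 (r i)) * survival (c- i) 0 J) +_) (trans
          (∑-distrib-+ {suc m} (λ _ → survival c 0 J) (λ i → indicator (above 0 (r i)) * (- survival c 0 J)))
          (trans (cong₂ _+_ (sum-const (suc m) (survival c 0 J))
              (trans (sym (*-distribʳ-sum {suc m} (- survival c 0 J) (λ i → indicator (above 0 (r i)))))
              (cong (_* (- survival c 0 J)) (sym (fromℕ-count (above 0) r)))))
            (solve 3 (λ N t Φ → N :* Φ :+ t :* (:- Φ) := N :* Φ :- t :* Φ) refl (fromℕ (suc m))
                (fromℕ (c 0)) (survival c 0 J))))))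
        where
        pointwise : ∀ i → survival (c- i) 0 J ≡ indicator (above 0 (r i)) * survival (c- i) 0 J +
                    (survival c 0 J + indicator (above 0 (r i)) * (- survival c 0 J))
        pointwise i with above 0 (r i) in eq
        ... | true  = solve 2 (λ x y → x := 1′ :* x :+ (y :+ 1′ :* (:- y))) refl _ (survival c 0 J)
        ... | false = trans (unchanged i 0 J (subst T eq))
          (solve 2 (λ x y → y := 0′ :* x :+ (y :+ 0′ :* (:- y))) refl (survival (c- i) 0 J) (survival c 0 J))

    -- The player accepts at the first pass, so every history it continues from consists of
    -- failures, which show all earlier values.
    seen : ℕ → History → ℕ
    seen s []             = 0
    seen s (passed ∷ h)   = seen s h
    seen s (failed x ∷ h) = toℕᵇ (above s x) ℕ.+ seen s h

    unseen : ∀ {n} → Vec ℝ n → History → ℕ → ℕ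
    unseen a h s = counts (Vec.lookup a) s ℕ.∸ seen s h

    -- No unseen value lies between the levels s and s + 1, and some value lies above
    -- them, so that testing at level s is bound to gain at least g.
    stopAt : ∀ {c} → Dec (IsolatedBelow J c) → Threshold
    stopAt (yes (s , _)) = finite (fromℕ s * g) (*-nonNegative (fromℕ-nonNeg s) 0≤g)
    stopAt (no _)        = ∞

  -- Dividing by J + 1 places the maximum one whole gap above level J, so that the count at level J
  -- is positive whenever the gap is.
  gap : ∀ {n} → Vec ℝ n → ℝ
  gap a = max 0# (Vec.toList a) / fromℕ (suc J)

  module _ {n} (a : Vec ℝ n) where
    open Extrema (DecTotalOrder.totalOrder decTotalOrder) using (⊥≤max)
    gap-nonNeg : 0# ≤ gap a
    gap-nonNeg = z*x≤y⇒z≤y/x (fromℕ-pos J) (subst (_≤ max 0# (Vec.toList a)) (sym (zeroʳ _))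
        (⊥≤max 0# (Vec.toList a)))

  isPass : History → Bool
  isPass (passed ∷ _) = true
  isPass _            = false

  player : ∀ n → Player n
  player n = record
    { space                = pointSpace
    ; threshold            = λ a h _ → let open Levels (gap a) (gap-nonNeg a) in stopAt
        (em {IsolatedBelow J (unseen a h)})
    ; accept               = λ _ h _ → isPass h
    ; threshold-measurable = λ _ _ _ → tt
    ; accept-measurable    = λ _ _ → tt
    }

  module Guarantee {n} (a : Vec ℝ n) where
    open Player (player n) using (play; expectedScore; score)
    g = gap a
    open Levels g (gap-nonNeg a)

    Consistent : History → ∀ {m} → (Fin m → ℝ) → Set
    Consistent h r = ∀ s → seen s h ℕ.+ counts r s ≡ counts (Vec.lookup a) s

    unseen-counts : ∀ h {m} (r : Fin m → ℝ) → Consistent h r → ∀ s → unseen a h s ≡ counts r s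
    unseen-counts h r consistent s = trans (cong (ℕ._∸ seen s h) (sym (consistent s)))
        (ℕ.m+n∸m≡n (seen s h) (counts r s))

    consistent-failed : ∀ h x {m} (r : Fin m → ℝ) →
        (∀ s → seen s h ℕ.+ (toℕᵇ (above s x) ℕ.+ counts r s) ≡ counts (Vec.lookup a) s) →
                        Consistent (failed x ∷ h) r
    consistent-failed h x r consistent s = trans
        (cong (ℕ._+ counts r s) (ℕ.+-comm (toℕᵇ (above s x)) (seen s h)))
      (trans (ℕ.+-assoc (seen s h) (toℕᵇ (above s x)) (counts r s)) (consistent s))

    counts-∷-∉ : ∀ s {x k} (xs : Vec ℝ k) → x ≤ fromℕ s * g → counts (Vec.lookup (x ∷ xs)) s ≡ counts
        (Vec.lookup xs) s
    counts-∷-∉ s {x} xs x≤ = cong (λ b → toℕᵇ b ℕ.+ counts (Vec.lookup xs) s) (¬T⇒false (≤⇒¬above {s} x≤))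
      where
      ¬T⇒false : ∀ {b} → ¬ T b → b ≡ false
      ¬T⇒false {true}  ¬t = ⊥-elim (¬t tt)
      ¬T⇒false {false} _  = refl

    counts-∷-∈ : ∀ s {x k} (xs : Vec ℝ k) → fromℕ s * g < x → counts (Vec.lookup (x ∷ xs)) s ≡ suc
        (counts (Vec.lookup xs) s)
    counts-∷-∈ s {x} xs x> = cong (λ b → toℕᵇ b ℕ.+ counts (Vec.lookup xs) s) (T⇒true (>⇒above {s} x>))
      where
      T⇒true : ∀ {b} → T b → b ≡ true
      T⇒true {true} _ = refl

    -- A value in the interval between the two levels would be counted at s but not at s + 1, which
    -- contradicts the equality of the counts.
    isolated-skips : ∀ s {x k} (xs : Vec ℝ k) → Isolated (counts (Vec.lookup (x ∷ xs))) s →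
                     fromℕ s * g < x → fromℕ (suc s) * g < x
    isolated-skips s {x} xs (eq , _) x> x≤next = ℕ.<⇒≱ (ℕ.n<1+n (counts (Vec.lookup xs) s)) (begin
        suc (counts (Vec.lookup xs) s)         ≡⟨ sym (counts-∷-∈ s xs x>) ⟩
        counts (Vec.lookup (x ∷ xs)) s         ≡⟨ sym eq ⟩
        counts (Vec.lookup (x ∷ xs)) (suc s)   ≡⟨ counts-∷-∉ (suc s) xs x≤next ⟩
        counts (Vec.lookup xs) (suc s)         ≤⟨ counts-antitone (Vec.lookup xs) s ⟩
        counts (Vec.lookup xs) s               ∎)
      where open ℕ.≤-Reasoning

    isolated-tail : ∀ s {x k} (xs : Vec ℝ k) → x ≤ fromℕ s * g → Isolated (counts (Vec.lookup (x ∷ xs))) s →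
                    Isolated (counts (Vec.lookup xs)) s
    isolated-tail s xs x≤ (eq , 0<cₛ) =
      trans (sym (counts-∷-∉ (suc s) xs (≤-trans x≤ (level-mono (ℕ.n≤1+n s)))))
          (trans eq (counts-∷-∉ s xs x≤)) ,
      subst (0 ℕ.<_) (counts-∷-∉ s xs x≤) 0<cₛ

    g≤gain : ∀ s {x} → fromℕ (suc s) * g < x → g ≤ x - fromℕ s * g
    g≤gain s {x} x> = transfer (<⇒≤ x>) (trans (+-comm g x) (trans (cong (x +_) (sym gap-eq))
        (solve 3 (λ x y z → x :+ (z :- y) := x :- y :+ z) refl x (fromℕ s * g) (fromℕ (suc s) * g))))
      where
      gap-eq : fromℕ (suc s) * g - fromℕ s * g ≡ g
      gap-eq = trans (cong (_- fromℕ s * g)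
          (trans (distribʳ g 1# (fromℕ s)) (cong (_+ fromℕ s * g) (*-identityˡ g))))
        (solve 2 (λ g y → g :+ y :- y := g) refl g (fromℕ s * g))

    -- The invariant is only that some isolated level exists; the level used may differ from step to
    -- step. A failure removes a value at or below the tested level and keeps that level isolated, a
    -- pass gains at least g, and the positive count keeps the values from running out before a
    -- pass.
    play-≥g : ∀ {k} (xs : Vec ℝ k) h → Consistent h (Vec.lookup xs) → IsolatedBelow J
        (counts (Vec.lookup xs)) →
              g ≤ play a tt h xs
    play-≥g []       h consistent (s , _ , _ , ())
    play-≥g (x ∷ xs) h consistent isolated = decide em
      where
      unseen≗ : ∀ s → unseen a h s ≡ counts (Vec.lookup (x ∷ xs)) s
      unseen≗ = unseen-counts h (Vec.lookup (x ∷ xs)) consistent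

      testAt : ∀ s 0≤θ → s ℕ.< J → Isolated (counts (Vec.lookup (x ∷ xs))) s → (d : Dec (x ≤ fromℕ s * g)) →
               g ≤ (if isPass ((if does d then failed x else passed) ∷ h) then remaining x
                   (finite (fromℕ s * g) 0≤θ)
                    else play a tt ((if does d then failed x else passed) ∷ h) xs)
      testAt s 0≤θ s<J iso (yes x≤) = play-≥g xs (failed x ∷ h)
          (consistent-failed h x (Vec.lookup xs) consistent)
        (s , s<J , isolated-tail s xs x≤ iso)
      testAt s 0≤θ s<J iso (no x≰) = ≤-trans (g≤gain s (isolated-skips s xs iso x≰))
        (≤-reflexive (sym (remaining-> {x} {fromℕ s * g} {0≤θ} (<⇒≤ x≰))))

      decide : (d : Dec (IsolatedBelow J (unseen a h))) →
               g ≤ (if isPass (test x (stopAt d) ∷ h) then remaining x (stopAt d) else play a tt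
                   (test x (stopAt d) ∷ h) xs)
      decide (no none) = ⊥-elim (none (IsolatedBelow-cong (λ s → sym (unseen≗ s)) isolated))
      decide (yes (s , s<J , eq , 0<cₛ)) = testAt s (*-nonNegative (fromℕ-nonNeg s) (gap-nonNeg a)) s<J
        (trans (sym (unseen≗ (suc s))) (trans eq (unseen≗ s)) , subst (0 ℕ.<_) (unseen≗ s) 0<cₛ)
            (x ≤? fromℕ s * g)

    -- The guaranteed mean gain when the values in `r` are still unseen.
    payoff : ∀ {m} → (Fin m → ℝ) → ℝ
    payoff r = g * (1# - survival (counts r) 0 J)

    payoff≤g : ∀ {m} (r : Fin m → ℝ) → payoff r ≤ g
    payoff≤g r = transfer (*-nonNegative (gap-nonNeg a) (survival-nonNeg (counts-antitone r) 0 J))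
      (trans (cong (_+ g * Φ) (trans (distribˡ g 1# (- Φ)) (cong (_+ g * (- Φ)) (*-identityʳ g))))
        (solve 2 (λ g Φ → g :+ g :* (:- Φ) :+ g :* Φ := g :+ 0′) refl g Φ))
      where Φ = survival (counts r) 0 J

    permSum-play-isolated : ∀ {m} (r : Fin m → ℝ) h → Consistent h r → IsolatedBelow J (counts r) →
                            #permutations m * payoff r ≤ permSum (play a tt h) r
    permSum-play-isolated {m} r h consistent isolated = permSum-≥ (play a tt h) r (payoff r) λ π →
        ≤-trans (payoff≤g r)
      (play-≥g (rearranged π) h
        (λ s → trans (cong (seen s h ℕ.+_) (count-permute (above s) r π)) (consistent s))
        (IsolatedBelow-cong {J} {counts r} {counts (Vec.lookup (rearranged π))}
            (λ s → sym (count-permute (above s) r π)) isolated))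
      where
      rearranged : Permutation′ m → Vec ℝ m
      rearranged π = Vec.tabulate (r ∘ (π ⟨$⟩ʳ_))

    -- With no values left the payoff is 0; with an isolated level the gain g is certain in every
    -- order. Otherwise the threshold ∞ reveals the next value and rejects it, and the mean payoff
    -- does not decrease because `survival` is superharmonic.
    permSum-play-≥ : ∀ {m} (r : Fin m → ℝ) h → Consistent h r → #permutations m * payoff r ≤ permSum
        (play a tt h) r
    permSum-play-≥ {zero} r h _ = permSum-≥ (play a tt h) r (payoff r) (λ _ → ≤-reflexive
      (trans (cong (λ Φ → g * (1# - Φ)) (survival-zero 0 J))
          (solve 2 (λ g o → g :* (o :- o) := 0′) refl g 1#)))
    permSum-play-≥ {suc m} r h consistent = decide em
      where
      open ≤-Reasoning using (begin_; step-≤; step-≡-⟩; _∎)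
      Φ = survival (counts r) 0 J
      Φ- : Fin (suc m) → ℝ
      Φ- i = survival (counts (r ∘ punchIn i)) 0 J
      -- The decision inside the player is generalised to an arbitrary d, since `em` does not
      -- compute; consistency of the history excludes the branch with an isolated level.
      reveal : ¬ IsolatedBelow J (counts r) → ∀ x (v : Vec ℝ m) (d : Dec (IsolatedBelow J (unseen a h))) →
          play a tt (failed x ∷ h) v ≡
        (if isPass (test x (stopAt d) ∷ h) then remaining x (stopAt d) else play a tt
            (test x (stopAt d) ∷ h) v)
      reveal none x v (no _) = refl
      reveal none x v (yes isolated) = ⊥-elim
          (none (IsolatedBelow-cong (unseen-counts h r consistent) isolated))
      decide : Dec (IsolatedBelow J (counts r)) → #permutations (suc m) * payoff r ≤ permSum (play a tt h) r
      decide (yes isolated) = permSum-play-isolated r h consistent isolated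
      decide (no none) = begin
          #permutations (suc m) * (g * (1# - Φ))
            ≡⟨ cong (_* (g * (1# - Φ))) (#permutations-suc m) ⟩
          fromℕ (suc m) * #permutations m * (g * (1# - Φ))
            ≡⟨ solve 5 (λ N p g o Φ → N :* p :* (g :* (o :- Φ)) := p :* g :* (N :* o :- N :* Φ)) refl
                (fromℕ (suc m)) (#permutations m) g 1# Φ ⟩
          #permutations m * g * (fromℕ (suc m) * 1# - fromℕ (suc m) * Φ)
            ≤⟨ *-monoˡ-≤ _ (*-nonNegative (0≤#permutations m) (gap-nonNeg a))
                 (transfer (survival-superharmonic r none)
                     (solve 3 (λ N Φ S → N :- Φ :+ Φ := N :- S :+ S) refl _ _ _)) ⟩
          #permutations m * g * (fromℕ (suc m) * 1# - sum Φ-)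
            ≡⟨ cong (#permutations m * g *_) (trans (cong₂ _+_ (sym (sum-const (suc m) 1#))
                 (trans (solve 1 (λ x → :- x := (:- 1′) :* x) refl (sum Φ-))
                     (*-distribˡ-sum {suc m} (- fromℕ 1) Φ-)))
                 (sym (∑-distrib-+ {suc m} (λ _ → 1#) (λ i → - fromℕ 1 * Φ- i)))) ⟩
          #permutations m * g * sum (λ i → 1# + - fromℕ 1 * Φ- i)
            ≡⟨ *-distribˡ-sum {suc m} (#permutations m * g) (λ i → 1# + - fromℕ 1 * Φ- i) ⟩
          sum (λ i → #permutations m * g * (1# + - fromℕ 1 * Φ- i))
            ≡⟨ sum-cong-≗ {suc m} (λ i → solve 4 (λ p g o Φ → p :* g :* (o :+ (:- 1′) :* Φ) := p :*
                (g :* (o :- Φ))) refl (#permutations m) g 1# (Φ- i)) ⟩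
          sum (λ i → #permutations m * payoff (r ∘ punchIn i))
            ≤⟨ sum-mono {suc m} (λ i → permSum-play-≥ (r ∘ punchIn i) (failed (r i) ∷ h)
                 (consistent-failed h (r i) (r ∘ punchIn i)
                     (λ s → trans (cong (seen s h ℕ.+_) (sym (count-remove (above s) r i)))
                         (consistent s)))) ⟩
          sum (λ i → permSum (play a tt (failed (r i) ∷ h)) (r ∘ punchIn i))
            ≡⟨ sum-cong-≗ {suc m} (λ i → permSum-cong (λ v → reveal none (r i) v em) (r ∘ punchIn i)) ⟩
          sum (λ i → permSum (λ v → play a tt h (r i ∷ v)) (r ∘ punchIn i))
            ≡⟨ sym (permSum-suc (play a tt h) r) ⟩
          permSum (play a tt h) r ∎

    expectedScore-≥ : payoff (Vec.lookup a) ≤ expectedScore a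
    expectedScore-≥ = *-cancelˡ-≤ (#permutations n) (0<#permutations n) (begin
      #permutations n * payoff (Vec.lookup a)
        ≤⟨ permSum-play-≥ (Vec.lookup a) [] (λ _ → refl) ⟩
      listSum (λ π → score a π tt) (allPermutations n)
        ≤⟨ listSum-mono (λ π → expectation-point (score a π)
            (play-nonNeg (player n) a tt [] (Vec.tabulate (λ i → Vec.lookup a (π ⟨$⟩ʳ i)))))
                (allPermutations n) ⟩
      listSum (λ π → ProbabilitySpace.expectation pointSpace (score a π)) (allPermutations n)
        ≡⟨ sym (#permutations*expectedScore (player n) a) ⟩
      #permutations n * expectedScore a ∎)
      where open ≤-Reasoning using (begin_; step-≤; step-≡-⟩; _∎)

    M = max 0# (Vec.toList a)

    M≡[1+J]g : M ≡ fromℕ (suc J) * g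
    M≡[1+J]g = sym (x*[y/x]≡y M (fromℕ-pos J))

    guarantee : ∀ q B → 1 ℕ.< q → J ≡ B ℕ.+ q → n ℕ.< q ℕ.^ suc B → M ≤ fromℕ (2 ℕ.* suc J) * expectedScore a
    guarantee q B 1<q J≡B+q n<q^ = begin
        M                                       ≡⟨ M≡[1+J]g ⟩
        fromℕ (suc J) * g                       ≤⟨ *-monoˡ-≤ _ (fromℕ-nonNeg (suc J)) g≤2E ⟩
        fromℕ (suc J) * (fromℕ 2 * E)           ≡⟨ solve 3 (λ j t e → j :* (t :* e) := t :* j :* e) refl
            (fromℕ (suc J)) (fromℕ 2) E ⟩
        fromℕ 2 * fromℕ (suc J) * E             ≡⟨ cong (_* E) (sym (fromℕ-* 2 (suc J))) ⟩
        fromℕ (2 ℕ.* suc J) * E                 ∎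
      where
      open ≤-Reasoning using (begin_; step-≤; step-≡-⟩; _∎)
      open Extrema (DecTotalOrder.totalOrder decTotalOrder) using (argmax-sel)
      E = expectedScore a
      Φ = survival (counts (Vec.lookup a)) 0 J
      2payoff≤2E : fromℕ 2 * (g * (1# - Φ)) ≤ fromℕ 2 * E
      2payoff≤2E = *-monoˡ-≤ (fromℕ 2) (fromℕ-nonNeg 2) expectedScore-≥
      -- With g = 0 no value lies strictly above level J, and the claim degenerates to a nonnegative
      -- score.
      zero-case : g ≡ 0# → g ≤ fromℕ 2 * E
      zero-case g≡0 = ≤-trans (≤-reflexive (trans g≡0 (sym (trans (cong (λ g → fromℕ 2 * (g * (1# - Φ))) g≡0)
        (solve 2 (λ t x → t :* (0′ :* x) := 0′) refl (fromℕ 2) _))))) 2payoff≤2E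
      positive-case : ∀ i → Vec.lookup a i ≡ M → 0# < g → g ≤ fromℕ 2 * E
      positive-case i aᵢ≡M 0<g = ≤-trans (transfer (*-monoˡ-≤ g (gap-nonNeg a) Φ≤½)
          (trans (solve 2 (λ g Φ → g :+ g :* 1′ := 2′ :* (g :* (1′ :- Φ)) :+ g :* (Φ :* 2′)) refl g Φ)
            (cong (λ o → fromℕ 2 * (g * (o - Φ)) + g * (Φ * fromℕ 2)) fromℕ-1)))
          2payoff≤2E
        where
        aᵢ>Jg : fromℕ J * g < Vec.lookup a i
        aᵢ>Jg aᵢ≤ = 0<g (transfer (subst (_≤ fromℕ J * g) (trans aᵢ≡M M≡[1+J]g) aᵢ≤)
          (trans (cong (_+ fromℕ J * g) (sym (*-identityˡ g)))
              (trans (sym (distribʳ g 1# (fromℕ J))) (sym (+-identityˡ _)))))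
        Φ≤½ : Φ * fromℕ 2 ≤ fromℕ 1
        Φ≤½ = subst (λ j → survival (counts (Vec.lookup a)) 0 j * fromℕ 2 ≤ fromℕ 1) (sym J≡B+q)
          (survival≤½ q B 1<q (counts-antitone (Vec.lookup a))
            (subst (λ j → 0 ℕ.< counts (Vec.lookup a) j) J≡B+q
                (count-pos (above J) (Vec.lookup a) i (>⇒above {J} aᵢ>Jg)))
            (ℕ.≤-<-trans (count≤n (above 0) (Vec.lookup a)) n<q^))
      g≤2E : g ≤ fromℕ 2 * E
      g≤2E with argmax-sel id 0# (Vec.toList a)
      ... | inj₁ M≡0 = zero-case (trans (cong (_/ fromℕ (suc J)) M≡0) (zeroˡ _))
      ... | inj₂ M∈a with g ≤? 0#
      ...   | yes g≤0 = zero-case (≤-antisym g≤0 (gap-nonNeg a))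
      ...   | no  0<g = positive-case (VecAny.index M∈) (sym (VecAny.lookup-index M∈)) 0<g
        where M∈ = ∈-toList⁻ M∈a

-- Integer logarithms and the choice of parameters.

powerBracket : ∀ b n → 1 ℕ.< b → 0 ℕ.< n → ∃[ k ] b ℕ.^ k ℕ.≤ n × n ℕ.< b ℕ.^ suc k
powerBracket b (suc zero)    1<b _ = 0 , ℕ.≤-refl , subst (1 ℕ.<_) (sym (ℕ.*-identityʳ b)) 1<b
powerBracket b (suc (suc n)) 1<b _ with powerBracket b (suc n) 1<b (ℕ.s≤s ℕ.z≤n)
... | k , lower , upper with suc (suc n) ℕ.<? b ℕ.^ suc k
...   | yes p = k , ℕ.≤-trans lower (ℕ.n≤1+n _) , p
...   | no ¬p = suc k , ℕ.≮⇒≥ ¬p , ℕ.≤-<-trans upper (ℕ.^-monoʳ-< b 1<b (ℕ.n<1+n (suc k)))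

n≤2^n : ∀ n → n ℕ.≤ 2 ℕ.^ n
n≤2^n zero    = ℕ.z≤n
n≤2^n (suc n) = ℕ.+-mono-≤ (ℕ.m^n>0 2 n) (ℕ.≤-trans (n≤2^n n) (ℕ.≤-reflexive (sym (ℕ.+-identityʳ _))))

-- The shift by 2 is essential: 4 n + 4 ≤ 4^n fails at n = 0 and n = 1. This inequality is the
-- source of the requirement `2≤l`.
4n+4≤4^n : ∀ n → 4 ℕ.* (2 ℕ.+ n) ℕ.+ 4 ℕ.≤ 4 ℕ.^ (2 ℕ.+ n)
4n+4≤4^n zero    = ℕ.m≤m+n 12 4
4n+4≤4^n (suc n) = begin
  4 ℕ.* (3 ℕ.+ n) ℕ.+ 4
      ≡⟨ solve 1 (λ n → con 4 :* (con 3 :+ n) :+ con 4 := con 4 :* (con 2 :+ n) :+ con 4 :+ con 4 :* con 1)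
          refl n ⟩
  4 ℕ.* (2 ℕ.+ n) ℕ.+ 4 ℕ.+ 4 ℕ.* 1    ≤⟨ ℕ.+-mono-≤ (4n+4≤4^n n)
      (ℕ.≤-trans (ℕ.m≤n+m 4 (4 ℕ.* (2 ℕ.+ n))) (4n+4≤4^n n)) ⟩
  4 ℕ.^ (2 ℕ.+ n) ℕ.+ 4 ℕ.^ (2 ℕ.+ n)  ≤⟨ ℕ.+-monoʳ-≤ (4 ℕ.^ (2 ℕ.+ n))
      (ℕ.m≤m+n (4 ℕ.^ (2 ℕ.+ n)) (2 ℕ.* 4 ℕ.^ (2 ℕ.+ n))) ⟩
  4 ℕ.* 4 ℕ.^ (2 ℕ.+ n)                ∎
  where
  open ℕ.≤-Reasoning
  open +-*-Solver

4^n≡2^[2*n] : ∀ n → 4 ℕ.^ n ≡ 2 ℕ.^ (2 ℕ.* n)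
4^n≡2^[2*n] n = ℕ.^-*-assoc 2 2 n

m<[1+m/n]*n : ∀ m n .{{_ : ℕ.NonZero n}} → m ℕ.< suc (m ℕ./ n) ℕ.* n
m<[1+m/n]*n m n = subst (ℕ._< suc (m ℕ./ n) ℕ.* n) (sym (ℕ.m≡m%n+[m/n]*n m n))
    (ℕ.+-monoˡ-< (m ℕ./ n ℕ.* n) (ℕ.m%n<n m n))

module Rates (R : RealNumbers) where
  open RealNumbers R
  open RealProperties R
  open PenTesting R using (log/loglog)

  -- Base 4 for the second logarithm makes 2^l at most √k, while the iterated logarithm still lies
  -- between 2 l and 2 (l + 1).
  record Scale (n : ℕ) : Set where
    field
      k l     : ℕ
      2≤l     : 2 ℕ.≤ l
      2^k≤n   : 2 ℕ.^ k ℕ.≤ n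
      n<2^1+k : n ℕ.< 2 ℕ.^ suc k
      4^l≤k   : 4 ℕ.^ l ℕ.≤ k
      k<4^1+l : k ℕ.< 4 ℕ.^ suc l

  scale : ∀ {n} → n ≥ 2 ℕ.^ 16 → Scale n
  scale {n} n≥ = record { k = k ; l = l ; 2≤l = 2≤l ; 2^k≤n = proj₁ (proj₂ K) ; n<2^1+k = proj₂ (proj₂ K)
                        ; 4^l≤k = proj₁ (proj₂ L) ; k<4^1+l = proj₂ (proj₂ L) }
    where
    K = powerBracket 2 n (ℕ.s≤s (ℕ.s≤s ℕ.z≤n)) (ℕ.<-≤-trans (ℕ.m^n>0 2 16) n≥)
    k = proj₁ K
    -- The threshold 2^16 for n is chosen so that k ≥ 16 = 4², which yields l ≥ 2.
    16≤k : 16 ℕ.≤ k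
    16≤k = ℕ.≮⇒≥ (λ k<16 → ℕ.<⇒≱ (proj₂ (proj₂ K)) (ℕ.≤-trans (ℕ.^-monoʳ-≤ 2 k<16) n≥))
    L = powerBracket 4 k (ℕ.s≤s (ℕ.s≤s ℕ.z≤n)) (ℕ.≤-trans (ℕ.s≤s ℕ.z≤n) 16≤k)
    l = proj₁ L
    2≤l : 2 ℕ.≤ l
    2≤l = ℕ.≮⇒≥ (λ l<2 → ℕ.<⇒≱ (proj₂ (proj₂ L)) (ℕ.≤-trans (ℕ.^-monoʳ-≤ 4 l<2) 16≤k))

  module _ {n} (sc : Scale n) where
    open Scale sc

    private
      log loglog : ℝ
      log    = log₂ (fromℕ n)
      loglog = log₂ log

      log-bounds : fromℕ k ≤ log × log ≤ fromℕ (suc k)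
      log-bounds = log₂-bounds k (suc k) (subst (_≤ fromℕ n) (fromℕ-^ 2 k) (fromℕ-mono 2^k≤n))
        (subst (fromℕ n ≤_) (fromℕ-^ 2 (suc k)) (fromℕ-mono (ℕ.<⇒≤ n<2^1+k)))

      loglog-bounds : fromℕ (2 ℕ.* l) ≤ loglog × loglog ≤ fromℕ (2 ℕ.* suc l)
      loglog-bounds = log₂-bounds (2 ℕ.* l) (2 ℕ.* suc l)
        (≤-trans (subst (_≤ fromℕ k) (fromℕ-^ 2 (2 ℕ.* l))
            (fromℕ-mono (subst (ℕ._≤ k) (4^n≡2^[2*n] l) 4^l≤k))) (proj₁ log-bounds))
        (≤-trans (proj₂ log-bounds) (subst (fromℕ (suc k) ≤_) (fromℕ-^ 2 (2 ℕ.* suc l))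
          (fromℕ-mono (subst (suc k ℕ.≤_) (4^n≡2^[2*n] (suc l)) k<4^1+l))))

      0<l : 0 ℕ.< l
      0<l = ℕ.<⇒≤ 2≤l

      0<loglog : 0# < loglog
      0<loglog = <-≤-trans (fromℕ-pos′ (ℕ.*-mono-≤ {1} {2} (ℕ.s≤s ℕ.z≤n) 0<l)) (proj₁ loglog-bounds)

    ≤-log/loglog : ∀ {x c} → x ℕ.* (2 ℕ.* suc l) ℕ.≤ c ℕ.* k → fromℕ x ≤ fromℕ c * log/loglog n
    ≤-log/loglog {x} {c} x≤ = subst (fromℕ x ≤_) (*-assoc (fromℕ c) log (loglog ⁻¹))
        (z*x≤y⇒z≤y/x 0<loglog (begin
      loglog * fromℕ x                 ≤⟨ *-monoʳ-≤ (fromℕ x) (fromℕ-nonNeg x) (proj₂ loglog-bounds) ⟩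
      fromℕ (2 ℕ.* suc l) * fromℕ x    ≡⟨ trans (*-comm _ _) (sym (fromℕ-* x (2 ℕ.* suc l))) ⟩
      fromℕ (x ℕ.* (2 ℕ.* suc l))      ≤⟨ fromℕ-mono x≤ ⟩
      fromℕ (c ℕ.* k)                  ≡⟨ fromℕ-* c k ⟩
      fromℕ c * fromℕ k                ≤⟨ *-monoˡ-≤ (fromℕ c) (fromℕ-nonNeg c) (proj₁ log-bounds) ⟩
      fromℕ c * log                    ∎))
      where open ≤-Reasoning using (begin_; step-≤; step-≡-⟩; _∎)

    log/loglog-≤ : ∀ {x} → suc k ℕ.≤ 2 ℕ.* l ℕ.* x → log/loglog n ≤ fromℕ x
    log/loglog-≤ {x} ≤x = y≤z*x⇒y/x≤z 0<loglog (begin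
      log                              ≤⟨ proj₂ log-bounds ⟩
      fromℕ (suc k)                    ≤⟨ fromℕ-mono ≤x ⟩
      fromℕ (2 ℕ.* l ℕ.* x)            ≡⟨ fromℕ-* (2 ℕ.* l) x ⟩
      fromℕ (2 ℕ.* l) * fromℕ x        ≤⟨ *-monoʳ-≤ (fromℕ x) (fromℕ-nonNeg x) (proj₁ loglog-bounds) ⟩
      loglog * fromℕ x                 ∎)
      where open ≤-Reasoning using (begin_; step-≤; step-≡-⟩; _∎)

module MainTheorem (em : ExcludedMiddle 0ℓ) (R : RealNumbers) where
  open RealNumbers R
  open RealProperties R hiding (solve; con; _:=_; _:+_; _:*_; _:-_; :-_)
  open PenTesting R
  open Rates R

  upperBound : ∀ {n} → Scale n → Σ[ P ∈ Player n ] P IsCompetitive (fromℕ 24 * log/loglog n)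
  upperBound {n} sc = player n , 0<α , competitive
    where
    open Scale sc
    instance
      l≢0 : ℕ.NonZero l
      l≢0 = ℕ.>-nonZero (ℕ.<⇒≤ 2≤l)
    q = 2 ℕ.^ l
    B = k ℕ./ l
    J = B ℕ.+ q
    open Algorithm em R J
    α = fromℕ 24 * log/loglog n

    1<q : 1 ℕ.< q
    1<q = ℕ.^-monoʳ-< 2 (ℕ.s≤s (ℕ.s≤s ℕ.z≤n)) (ℕ.<⇒≤ 2≤l)

    n<q^1+B : n ℕ.< q ℕ.^ suc B
    n<q^1+B = ℕ.<-≤-trans n<2^1+k (subst (2 ℕ.^ suc k ℕ.≤_) (sym (ℕ.^-*-assoc 2 l (suc B)))
      (ℕ.^-monoʳ-≤ 2 (subst (suc k ℕ.≤_) (ℕ.*-comm (suc B) l) (m<[1+m/n]*n k l))))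

    q*q≤k : q ℕ.* q ℕ.≤ k
    q*q≤k = subst (ℕ._≤ k) (trans (4^n≡2^[2*n] l) (trans (cong (2 ℕ.^_) (cong (l ℕ.+_) (ℕ.+-identityʳ l)))
        (ℕ.^-distribˡ-+-* 2 l l))) 4^l≤k

    -- The factor 2 (l + 1), an upper bound for the iterated logarithm, is at most 4 l. Each of B l,
    -- l q and l is at most k, the last two through l ≤ q and q² ≤ k, so the constant is 8 * 3 = 24.
    size : 2 ℕ.* suc J ℕ.* (2 ℕ.* suc l) ℕ.≤ 24 ℕ.* k
    size = begin
      2 ℕ.* suc J ℕ.* (2 ℕ.* suc l)    ≤⟨ ℕ.*-monoʳ-≤ (2 ℕ.* suc J)
          (ℕ.*-monoʳ-≤ 2 (ℕ.+-monoˡ-≤ l (ℕ.<⇒≤ 2≤l))) ⟩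
      2 ℕ.* suc J ℕ.* (2 ℕ.* (l ℕ.+ l))
          ≡⟨ solve 3 (λ B q l → con 2 :* (con 1 :+ (B :+ q)) :* (con 2 :* (l :+ l)) :=
                                              con 8 :* (B :* l :+ (l :* q :+ l))) refl B q l ⟩
      8 ℕ.* (B ℕ.* l ℕ.+ (l ℕ.* q ℕ.+ l)) ≤⟨ ℕ.*-monoʳ-≤ 8 (ℕ.+-mono-≤ (ℕ.m/n*n≤m k l)
                                                (ℕ.+-mono-≤ (ℕ.≤-trans (ℕ.*-monoˡ-≤ q (n≤2^n l)) q*q≤k)
                                                  (ℕ.≤-trans (n≤2^n l) (ℕ.≤-trans
                                                      (ℕ.m≤m*n q q {{ℕ.>-nonZero (ℕ.<⇒≤ 1<q)}}) q*q≤k)))) ⟩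
      8 ℕ.* (k ℕ.+ (k ℕ.+ k))          ≡⟨ solve 1 (λ k → con 8 :* (k :+ (k :+ k)) := con 24 :* k) refl k ⟩
      24 ℕ.* k                         ∎
      where
      open ℕ.≤-Reasoning
      open +-*-Solver

    2[1+J]≤α : fromℕ (2 ℕ.* suc J) ≤ α
    2[1+J]≤α = ≤-log/loglog sc {2 ℕ.* suc J} {24} size

    0<α : 0# < α
    0<α = <-≤-trans (fromℕ-pos′ {2 ℕ.* suc J} (ℕ.s≤s ℕ.z≤n)) 2[1+J]≤α

    competitive : ∀ a → _ → 1# / α * max 0# (Vec.toList a) ≤ Player.expectedScore (player n) a
    competitive a _ = subst (_≤ E) (trans (*-comm M (α ⁻¹)) (cong (_* M) (sym (*-identityˡ (α ⁻¹)))))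
      (y≤z*x⇒y/x≤z 0<α (≤-trans M≤ (*-monoʳ-≤ E 0≤E 2[1+J]≤α)))
      where
      open Guarantee a using (M; guarantee; M≡[1+J]g)
      E = Player.expectedScore (player n) a
      M≤ : M ≤ fromℕ (2 ℕ.* suc J) * E
      M≤ = guarantee q B 1<q refl n<q^1+B
      0≤E : 0# ≤ E
      0≤E = *-cancelˡ-≤ (fromℕ (2 ℕ.* suc J)) (fromℕ-pos′ {2 ℕ.* suc J} (ℕ.s≤s ℕ.z≤n)) (≤-trans
        (≤-reflexive (zeroʳ _)) (≤-trans
            (subst (0# ≤_) (sym M≡[1+J]g) (*-nonNegative (fromℕ-nonNeg (suc J)) (gap-nonNeg a))) M≤))

  lowerBound : ∀ {n} → Scale n → ∀ α → Σ[ P ∈ Player n ] P IsCompetitive α → log/loglog n ≤ fromℕ 32 * α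
  lowerBound {n} sc α (P , competitive) = begin
      log/loglog n                ≤⟨ log/loglog-≤ sc size ⟩
      fromℕ (8 ℕ.* J)             ≡⟨ fromℕ-* 8 J ⟩
      fromℕ 8 * fromℕ J           ≤⟨ *-monoˡ-≤ (fromℕ 8) (fromℕ-nonNeg 8)
          (hardInstance Q (ℕ.m^n>0 2 b) J²≤Q Q^J≤n P α competitive) ⟩
      fromℕ 8 * (fromℕ 4 * α)     ≡⟨ trans (sym (*-assoc _ _ α)) (cong (_* α) (sym (fromℕ-* 8 4))) ⟩
      fromℕ 32 * α                ∎
    where
    open ≤-Reasoning using (begin_; step-≤; step-≡-⟩; _∎)
    open Scale sc
    -- The exponent makes Q the square of 4^(l + 1), which exceeds k and therefore J.
    b = 4 ℕ.* l ℕ.+ 4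
    instance
      b≢0 : ℕ.NonZero b
      b≢0 = ℕ.>-nonZero (ℕ.≤-trans (ℕ.s≤s ℕ.z≤n) (ℕ.m≤n+m 4 (4 ℕ.* l)))
    Q = 2 ℕ.^ b
    J = k ℕ./ b
    open Hardness em R J

    J≤4^1+l : J ℕ.≤ 4 ℕ.^ suc l
    J≤4^1+l = ℕ.≤-trans (ℕ.m/n≤m k b) (ℕ.<⇒≤ k<4^1+l)

    J²≤Q : J ℕ.* J ℕ.≤ Q
    J²≤Q = ℕ.≤-trans (ℕ.*-mono-≤ J≤4^1+l J≤4^1+l) (ℕ.≤-reflexive (trans
      (cong₂ ℕ._*_ (4^n≡2^[2*n] (suc l)) (4^n≡2^[2*n] (suc l)))
      (trans (sym (ℕ.^-distribˡ-+-* 2 (2 ℕ.* suc l) (2 ℕ.* suc l)))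
        (cong (2 ℕ.^_) (solve 1 (λ l → con 2 :* (con 1 :+ l) :+ con 2 :* (con 1 :+ l) := con 4 :* l :+ con
            4) refl l)))))
      where open +-*-Solver

    Q^J≤n : Q ℕ.^ J ℕ.≤ n
    Q^J≤n = ℕ.≤-trans (ℕ.≤-reflexive (ℕ.^-*-assoc 2 b J))
      (ℕ.≤-trans (ℕ.^-monoʳ-≤ 2 (subst (ℕ._≤ k) (ℕ.*-comm J b) (ℕ.m/n*n≤m k b))) 2^k≤n)

    -- This gives J ≥ 1, so that the rounding in J = k / b costs only a factor of 2.
    b≤k : b ℕ.≤ k
    b≤k = ℕ.≤-trans (subst (λ l → 4 ℕ.* l ℕ.+ 4 ℕ.≤ 4 ℕ.^ l) (ℕ.m+[n∸m]≡n 2≤l) (4n+4≤4^n (l ℕ.∸ 2))) 4^l≤k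

    -- From J + 1 ≤ 2 J and b ≤ 8 l comes k + 1 ≤ 16 J l, that is 2 l times 8 J; with the score
    -- bound 4 of the hard instance the constant becomes 32.
    size : suc k ℕ.≤ 2 ℕ.* l ℕ.* (8 ℕ.* J)
    size = N.begin
      suc k                     N.≤⟨ m<[1+m/n]*n k b ⟩
      suc J ℕ.* b               N.≤⟨ ℕ.*-mono-≤ (ℕ.+-monoˡ-≤ J (ℕ.m≥n⇒m/n>0 b≤k))
          (ℕ.+-monoʳ-≤ (4 ℕ.* l) (ℕ.*-monoʳ-≤ 4 (ℕ.<⇒≤ 2≤l))) ⟩
      (J ℕ.+ J) ℕ.* (4 ℕ.* l ℕ.+ 4 ℕ.* l)
          N.≡⟨ solve 2 (λ J l → (J :+ J) :* (con 4 :* l :+ con 4 :* l) := con 2 :* l :* (con 8 :* J)) refl J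
              l ⟩
      2 ℕ.* l ℕ.* (8 ℕ.* J)     N.∎
      where
      module N = ℕ.≤-Reasoning
      open +-*-Solver

theorem5 :
    ExcludedMiddle 0ℓ → (R : RealNumbers) →
    let open RealNumbers R
        open PenTesting R
    in
    Σ[ C ∈ ℝ ] Σ[ c ∈ ℝ ] (0# < C × 0# < c ×
      (Σ[ n₀ ∈ ℕ ] (∀ (n : ℕ) → n ≥ n₀ →
        (Σ[ P ∈ Player n ] P IsCompetitive (C * log/loglog n)) ×
        (∀ (α : ℝ) → (Σ[ P ∈ Player n ] P IsCompetitive α) → c * log/loglog n ≤ α))))
theorem5 em R = fromℕ 24 , 1# / fromℕ 32 , fromℕ-pos 23 , 0<1/32 , 2 ℕ.^ 16 , λ n n≥ →
  upperBound (scale n≥) , λ α player → subst (_≤ α) (*-assoc-1/ (log/loglog n))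
    (y≤z*x⇒y/x≤z (fromℕ-pos 31) (lowerBound (scale n≥) α player))
  where
  open RealNumbers R
  open RealProperties R
  open PenTesting R
  open Rates R
  open MainTheorem em R
  0<1/32 : 0# < 1# / fromℕ 32
  0<1/32 p = 0<1 (subst₂ _≤_ (x*[y/x]≡y 1# (fromℕ-pos 31)) (zeroʳ (fromℕ 32))
      (*-monoˡ-≤ (fromℕ 32) (fromℕ-nonNeg 32) p))
  *-assoc-1/ : ∀ x → x / fromℕ 32 ≡ 1# / fromℕ 32 * x
  *-assoc-1/ x = trans (*-comm x _) (cong (_* x) (sym (*-identityˡ _)))
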